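{- Let $d$ be a positive integer and set $k=2^{2d+3}$. If $\mathbf{G}=(V,E)$ is a finite graph of diameter at most $d$ and (vertex) connectivity at least $k$, then the pebbling number of $\mathbf{G}$ is $|V|$, i.e. $f(\mathbf{G})=|V|$.
   Context: For a finite graph $\mathbf{G}=(V,E)$, a pebbling is a function $\phi:V\to\mathbb{N}_0$ (number of pebbles on each vertex); its size is $\sum_{x\in V}\phi(x)$. A pebbling move takes a vertex $x$ with $\phi(x)\ge 2$, removes two pebbles from $x$ and adds one pebble to a vertex $y$ adjacent to $x$. A descendant of $\phi$ is any pebbling obtained from $\phi$ by a finite sequence of pebbling moves (including zero moves). $\phi$ has the potential to pebble $x$ if $\phi$ or one of its descendants assigns a positive number of pebbles to $x$. The pebbling number $f(\mathbf{G})$ is the least $p$ such that for every pebbling $\phi$ of size $p$ and every vertex $x\in V$, $\phi$ has the potential to pebble $x$. A graph is called Class $0$ if $f(\mathbf{G})=|V|$. -}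

module Defs where

open import Level using (0ℓ)
open import Data.Nat using (ℕ; zero; suc; _+_; _∸_; _^_; _*_; _≤_; _<_; _≥_)
open import Data.Fin using (Fin)
open import Data.Fin.Subset using (Subset; _∈_; _∉_; ∣_∣)
open import Data.List using (List; map; allFin)
open import Data.Nat.ListAction using (sum)
open import Data.Product using (Σ; ∃; ∃-syntax; _×_; _,_)
open import Data.Unit using (⊤)
open import Relation.Nullary using (¬_; Dec; yes; no)
open import Relation.Binary.PropositionalEquality using (_≡_)
open import Relation.Binary.Construct.Closure.ReflexiveTransitive using (Star)
open import Data.Fin using (_≟_)

record Graph (n : ℕ) : Set₁ where
  field
    Adj     : Fin n → Fin n → Set
    symm    : ∀ {x y} → Adj x y → Adj y x
    irrefl  : ∀ {x} → ¬ Adj x x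
open Graph public

data WalkIn {n : ℕ} (G : Graph n) (P : Fin n → Set) : Fin n → Fin n → ℕ → Set where
  here : ∀ {u} → P u → WalkIn G P u u 0
  step : ∀ {u w v ℓ} → P u → Adj G u w → WalkIn G P w v ℓ → WalkIn G P u v (suc ℓ)

DiameterAtMost : ∀ {n} → Graph n → ℕ → Set
DiameterAtMost {n} G d = ∀ (u v : Fin n) → ∃[ ℓ ] (ℓ ≤ d × WalkIn G (λ _ → ⊤) u v ℓ)

ConnectivityAtLeast : ∀ {n} → Graph n → ℕ → Set
ConnectivityAtLeast {n} G k =
  k < n × (∀ (S : Subset n) → ∣ S ∣ < k → ∀ (u v : Fin n) → u ∉ S → v ∉ S →
            ∃[ ℓ ] WalkIn G (λ x → x ∉ S) u v ℓ)

Pebbling : ℕ → Set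
Pebbling n = Fin n → ℕ

size : ∀ {n} → Pebbling n → ℕ
size {n} φ = sum (map φ (allFin n))

afterMove : ∀ {n} → Pebbling n → Fin n → Fin n → Fin n → ℕ
afterMove φ x y z with z ≟ x
... | yes _ = φ z ∸ 2
... | no _ with z ≟ y
...   | yes _ = suc (φ z)
...   | no _ = φ z

data Move {n : ℕ} (G : Graph n) (φ ψ : Pebbling n) : Set where
  move : (x y : Fin n) → Adj G x y → 2 ≤ φ x →
         (∀ z → ψ z ≡ afterMove φ x y z) → Move G φ ψ

Descendant : ∀ {n} → Graph n → Pebbling n → Pebbling n → Set
Descendant G = Star (Move G)

CanPebble : ∀ {n} → Graph n → Pebbling n → Fin n → Set
CanPebble G φ x = ∃[ ψ ] (Descendant G φ ψ × 1 ≤ ψ x)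

Solvable : ∀ {n} → Graph n → ℕ → Set
Solvable {n} G p = ∀ (φ : Pebbling n) → size φ ≡ p → ∀ (x : Fin n) → CanPebble G φ x

PebblingNumberIs : ∀ {n} → Graph n → ℕ → Set
PebblingNumberIs G p = Solvable G p × (∀ q → Solvable G q → p ≤ q)

{-# OPTIONS --safe #-}
module Submission where

-- Put t = 2^d; a vertex holding t pebbles can pebble any vertex. A family of moves
-- spending at most what is available at every vertex can be ordered into a sequence of
-- moves, so Hall's theorem gives a Menger-type dichotomy: either a vertex v gains j
-- pebbles, or there is a set A containing v, all of whose other vertices carry exactly
-- one pebble, such that its outer boundary N(A) has capacity less than j. Here a vertex
-- with one pebble has capacity 1, and one with p ≠ 1 pebbles has capacity ⌊p/2⌋.
--
-- Suppose the target x cannot be pebbled. Let Z be the set of empty vertices and let β be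
-- the capacity restricted to vertices with at least two pebbles, so that |Z| ≤ 2 Σ β.
-- The dichotomy at x with j = 1 gives |Z| ≥ k = 8t². Choose minimal cuts A(v) for j = t.
-- As N(A(b)) has at least k vertices or contains Z, it contains at least 7t² vertices
-- of Z whenever b has two pebbles. By double counting some z in Z lies in N(A(b)) for
-- a set of b with β-weight at least 7t²/2. By minimality each such A(b) meets N(A(z)),
-- which has fewer than t vertices outside Z. By posimodularity of the boundary
-- capacity, two minimal cuts A(b), A(b′) can only meet if b ∈ N(A(b′)) or b′ ∈ N(A(b)),
-- so the b with a given s in A(b) have β-weight at most 3t. Thus 7t²/2 ≤ 3t², which is absurd.

open import Defs
open import Data.Bool using (Bool; true; false; not; _∧_; _∨_)
import Data.Bool.Properties as Bool
open import Data.Empty using (⊥; ⊥-elim)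
open import Data.Fin using (Fin; zero; suc; toℕ; _↑ˡ_; _↑ʳ_; splitAt)
open import Data.Fin.Properties as Fin using (any?; all?; splitAt-↑ˡ; splitAt-↑ʳ)
open import Data.Fin.Subset using (Subset; _∉_; ∣_∣; inside; outside)
open import Data.Fin.Subset.Properties using (anySubset?; _∈?_)
open import Data.List as List using (List; []; _∷_; _++_)
open import Data.List.Properties using (map-tabulate)
open import Data.List.Relation.Unary.Any as Any using (Any; here; there)
open import Data.List.Relation.Unary.Any.Properties using (++⁺ˡ; ++⁺ʳ)
open import Data.Nat using (ℕ; zero; suc; _+_; _*_; _∸_; _^_; _≤_; _<_; z≤n; s≤s; _≤?_; _<?_; _<ᵇ_; ⌊_/2⌋)
import Data.Nat.ListAction as ListAction
open import Data.Nat.Properties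
open import Data.Nat.Tactic.RingSolver using (solve-∀)
open import Data.Product using (Σ; ∃; ∃-syntax; _×_; _,_; proj₁; proj₂)
open import Data.Product.Properties using (≡-dec)
open import Data.Sum using (_⊎_; inj₁; inj₂; [_,_]′; swap; map₁)
open import Data.Unit using (⊤)
open import Data.Vec as Vec using ()
open import Data.Vec.Properties using (lookup∘tabulate; []=⇒lookup; lookup⇒[]=)
open import Function using (_∘_; id)
open import Relation.Binary.Construct.Closure.ReflexiveTransitive using (ε; _◅_; _◅◅_; gmap)
open import Relation.Binary.PropositionalEquality
open import Relation.Nullary using (¬_; Dec; yes; no; does; contradiction)
open import Relation.Nullary.Decidable using (_×-dec_; _⊎-dec_; _→-dec_; ¬?; dec-true; dec-false)
import Algebra.Properties.Semiring.Sum +-*-semiring as Sum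

-- Finite sums.

-- Opaque so that unification treats ∑ as injective.
opaque
  ∑ : ∀ {n} → (Fin n → ℕ) → ℕ
  ∑ = Sum.sum

  ∑-cong : ∀ {n} {f g : Fin n → ℕ} → f ≗ g → ∑ f ≡ ∑ g
  ∑-cong = Sum.sum-cong-≗

  ∑-distrib-+ : ∀ {n} (f g : Fin n → ℕ) → ∑ (λ i → f i + g i) ≡ ∑ f + ∑ g
  ∑-distrib-+ = Sum.∑-distrib-+

  ∑-comm : ∀ {m n} (f : Fin m → Fin n → ℕ) → ∑ (λ i → ∑ (f i)) ≡ ∑ λ j → ∑ λ i → f i j
  ∑-comm = Sum.∑-comm

  *-distribˡ-∑ : ∀ {n} x (f : Fin n → ℕ) → x * ∑ f ≡ ∑ λ i → x * f i
  *-distribˡ-∑ = Sum.*-distribˡ-sum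

  *-distribʳ-∑ : ∀ {n} x (f : Fin n → ℕ) → ∑ f * x ≡ ∑ λ i → f i * x
  *-distribʳ-∑ = Sum.*-distribʳ-sum

  ∑-mono-≤ : ∀ {n} {f g : Fin n → ℕ} → (∀ i → f i ≤ g i) → ∑ f ≤ ∑ g
  ∑-mono-≤ {zero}  f≤g = z≤n
  ∑-mono-≤ {suc n} f≤g = +-mono-≤ (f≤g zero) (∑-mono-≤ (f≤g ∘ suc))

  ∑-mono-< : ∀ {n} {f g : Fin n → ℕ} → (∀ i → f i ≤ g i) →
               ∀ i → f i < g i → ∑ f < ∑ g
  ∑-mono-< f≤g zero    f<g = +-mono-<-≤ f<g (∑-mono-≤ (f≤g ∘ suc))
  ∑-mono-< f≤g (suc i) f<g = +-mono-≤-< (f≤g zero) (∑-mono-< (f≤g ∘ suc) i f<g)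

  term≤∑ : ∀ {n} (f : Fin n → ℕ) i → f i ≤ ∑ f
  term≤∑ f zero    = m≤m+n _ _
  term≤∑ f (suc i) = ≤-trans (term≤∑ (f ∘ suc) i) (m≤n+m _ _)

  ∑-pos⇒∃ : ∀ {n} (f : Fin n → ℕ) → 1 ≤ ∑ f → ∃[ i ] 1 ≤ f i
  ∑-pos⇒∃ {suc n} f 1≤ with f zero in eq
  ... | suc _ = zero , subst (1 ≤_) (sym eq) (s≤s z≤n)
  ... | zero with ∑-pos⇒∃ (f ∘ suc) 1≤
  ...   | i , p = suc i , p

  ∑-zero : ∀ {n} (f : Fin n → ℕ) → (∀ i → f i ≡ 0) → ∑ f ≡ 0
  ∑-zero {n} f f≡0 = trans (∑-cong f≡0) (Sum.sum-replicate-zero n)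

  ∑-one : ∀ n → ∑ {n} (λ _ → 1) ≡ n
  ∑-one zero    = refl
  ∑-one (suc n) = cong suc (∑-one n)

  ≤∧∑≡⇒≡ : ∀ {n} {f g : Fin n → ℕ} → (∀ i → f i ≤ g i) → ∑ f ≡ ∑ g →
             ∀ i → f i ≡ g i
  ≤∧∑≡⇒≡ {f = f} {g} f≤g eq i with f i <? g i
  ... | yes f<g = contradiction eq (<⇒≢ (∑-mono-< f≤g i f<g))
  ... | no  f≮g = ≤-antisym (f≤g i) (≮⇒≥ f≮g)

  ∑-++ : ∀ m {n} (f : Fin (m + n) → ℕ) →
           ∑ f ≡ ∑ (λ i → f (i ↑ˡ n)) + ∑ (λ i → f (m ↑ʳ i))
  ∑-++ zero    f = refl
  ∑-++ (suc m) f = trans (cong (f zero +_) (∑-++ m (f ∘ suc))) (sym (+-assoc (f zero) _ _))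

-- Indicators, Boolean sets and their weights.

𝟙 : Bool → ℕ
𝟙 true  = 1
𝟙 false = 0

𝟙≤1 : ∀ b → 𝟙 b ≤ 1
𝟙≤1 true  = ≤-refl
𝟙≤1 false = z≤n

𝟙-true : ∀ {b} → 1 ≤ 𝟙 b → b ≡ true
𝟙-true {true} _ = refl

𝟙-pos : ∀ {b} → b ≡ true → 1 ≤ 𝟙 b
𝟙-pos refl = ≤-refl

𝟙-mono : ∀ {a b} → (a ≡ true → b ≡ true) → 𝟙 a ≤ 𝟙 b
𝟙-mono {false} a⇒b = z≤n
𝟙-mono {true}  a⇒b = 𝟙-pos (a⇒b refl)

𝟙-pair : ∀ {p q r s} → (p ≡ true → r ≡ true ⊎ s ≡ true) → (q ≡ true → r ≡ true ⊎ s ≡ true) →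
         (p ≡ true → q ≡ true → r ≡ true × s ≡ true) → 𝟙 p + 𝟙 q ≤ 𝟙 r + 𝟙 s
𝟙-pair {false} {false} _ _ _ = z≤n
𝟙-pair {true} {true} _ _ h with refl , refl ← h refl refl = ≤-refl
𝟙-pair {true} {false} {r} h _ _ with h refl
... | inj₁ refl = s≤s z≤n
... | inj₂ refl = m≤n+m 1 (𝟙 r)
𝟙-pair {false} {true} {r} _ h _ with h refl
... | inj₁ refl = s≤s z≤n
... | inj₂ refl = m≤n+m 1 (𝟙 r)

true-or-false : ∀ b → b ≡ true ⊎ b ≡ false
true-or-false true  = inj₁ refl
true-or-false false = inj₂ refl

≢true⇒false : ∀ {b} → ¬ b ≡ true → b ≡ false
≢true⇒false {false} _ = refl
≢true⇒false {true}  h = contradiction refl h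

true≢false : ∀ {b} → b ≡ true → b ≡ false → ⊥
true≢false refl ()

∧-true : ∀ {a b} → a ∧ b ≡ true → a ≡ true × b ≡ true
∧-true {true} {true} _ = refl , refl

∨-true : ∀ {a b} → a ∨ b ≡ true → a ≡ true ⊎ b ≡ true
∨-true {true}  _ = inj₁ refl
∨-true {false} p = inj₂ p

∨-trueʳ : ∀ {a b} → b ≡ true → a ∨ b ≡ true
∨-trueʳ {true}  _ = refl
∨-trueʳ {false} p = p

fromDec : ∀ {p} {P : Set p} → Dec P → P ⊎ ¬ P
fromDec (yes p) = inj₁ p
fromDec (no ¬p) = inj₂ ¬p

does-true : ∀ {p} {P : Set p} (P? : Dec P) → does P? ≡ true → P
does-true (yes p) _ = p

_==_ : ∀ {n} → Fin n → Fin n → Bool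
i == j = does (i Fin.≟ j)

≡-or-≢ : ∀ {n} (i j : Fin n) → i ≡ j ⊎ ¬ i ≡ j
≡-or-≢ i j = fromDec (i Fin.≟ j)

==-refl : ∀ {n} (i : Fin n) → (i == i) ≡ true
==-refl i = dec-true (i Fin.≟ i) refl

==-≡ : ∀ {n} {i j : Fin n} → (i == j) ≡ true → i ≡ j
==-≡ {i = i} {j} = does-true (i Fin.≟ j)

opaque
  unfolding ∑

  ∑-δ : ∀ {n} (f : Fin n → ℕ) i → ∑ (λ j → f j * 𝟙 (j == i)) ≡ f i
  ∑-δ f zero = trans (cong (f zero * 1 +_) (∑-zero _ λ j → *-zeroʳ (f (suc j))))
                       (trans (+-identityʳ _) (*-identityʳ _))
  ∑-δ f (suc i) = trans (cong (_+ ∑ (λ j → f (suc j) * 𝟙 (j == i))) (*-zeroʳ (f zero))) (∑-δ (f ∘ suc) i)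

wt : ∀ {n} → (Fin n → ℕ) → (Fin n → Bool) → ℕ
wt w A = ∑ λ i → w i * 𝟙 (A i)

wt-mono : ∀ {n} (w : Fin n → ℕ) A B → (∀ i → A i ≡ true → B i ≡ true) → wt w A ≤ wt w B
wt-mono w A B A⊆B = ∑-mono-≤ λ i → *-monoʳ-≤ (w i) (𝟙-mono (A⊆B i))

wt-cong : ∀ {n} (w : Fin n → ℕ) A B → A ≗ B → wt w A ≡ wt w B
wt-cong w A B A≗B = ∑-cong λ i → cong (λ b → w i * 𝟙 b) (A≗B i)

-- The search runs over the finitely many bit vectors. Functions that agree pointwise need not be
-- equal, so `P` has to respect `≗`.
search : ∀ {n p} {P : (Fin n → Bool) → Set p} → (∀ A → Dec (P A)) →
         (∀ {A B} → A ≗ B → P A → P B) → Dec (∃ P)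
search P? resp with anySubset? (λ S → P? (Vec.lookup S))
... | yes (S , p) = yes (Vec.lookup S , p)
... | no ¬p = no λ (A , p) → ¬p (Vec.tabulate A , resp (λ i → sym (lookup∘tabulate A i)) p)

-- Hall's theorem with capacities

private
  variable
    m n : ℕ

opaque
  -- The neighbourhood of `Y` in the bipartite graph `R`.
  anyOf : (Fin m → Bool) → (Fin m → Fin n → Bool) → Fin n → Bool
  anyOf Y R u = does (any? λ i → (Y i Bool.≟ true) ×-dec (R i u Bool.≟ true))

  anyOf-intro : ∀ (Y : Fin m → Bool) (R : Fin m → Fin n → Bool) {u} i →
                Y i ≡ true → R i u ≡ true → anyOf Y R u ≡ true
  anyOf-intro Y R i Yi Riu = dec-true (any? _) (i , Yi , Riu)

  anyOf-elim : ∀ (Y : Fin m → Bool) (R : Fin m → Fin n → Bool) {u} →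
               anyOf Y R u ≡ true → ∃[ i ] Y i ≡ true × R i u ≡ true
  anyOf-elim Y R = does-true (any? _)

module Hall (r : Fin m → ℕ) (r≤1 : ∀ i → r i ≤ 1) (c : Fin n → ℕ) where

  Relation : Set
  Relation = Fin m → Fin n → Bool

  Violates : Relation → (Fin m → Bool) → Set
  Violates R Y = wt c (anyOf Y R) < wt r Y

  HallCondition : Relation → Set
  HallCondition R = ∀ Y → wt r Y ≤ wt c (anyOf Y R)

  anyOf-⊆ : ∀ (R : Relation) {Y Y′} → Y ≗ Y′ → ∀ u → anyOf Y R u ≡ true → anyOf Y′ R u ≡ true
  anyOf-⊆ R {Y} {Y′} Y≗Y′ u h with i , Yi , Riu ← anyOf-elim Y R h =
    anyOf-intro Y′ R i (trans (sym (Y≗Y′ i)) Yi) Riu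

  violates-cong : ∀ R {Y Y′} → Y ≗ Y′ → Violates R Y → Violates R Y′
  violates-cong R Y≗Y′ v =
    ≤-<-trans (wt-mono c _ _ (anyOf-⊆ R λ i → sym (Y≗Y′ i))) (<-≤-trans v (≤-reflexive (wt-cong r _ _ Y≗Y′)))

  violator? : ∀ R → (∃ (Violates R)) ⊎ HallCondition R
  violator? R with search (λ Y → wt c (anyOf Y R) <? wt r Y) (violates-cong R)
  ... | yes v = inj₁ v
  ... | no ¬v = inj₂ λ Y → ≮⇒≥ λ v → ¬v (Y , v)

  delete : Fin m → Fin n → Relation → Relation
  delete i u R l v = R l v ∧ not ((l == i) ∧ (v == u))

  delete-⊆ : ∀ i u R {l v} → delete i u R l v ≡ true → R l v ≡ true
  delete-⊆ i u R h = proj₁ (∧-true h)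

  delete-keep : ∀ i u R {l v} → R l v ≡ true → ¬ (l ≡ i × v ≡ u) → delete i u R l v ≡ true
  delete-keep i u R {l} {v} Rlv ne with (l == i) in p | (v == u) in q
  ... | false | _     = trans (cong (_∧ true) Rlv) refl
  ... | true  | false = trans (cong (_∧ true) Rlv) refl
  ... | true  | true  = contradiction (==-≡ p , ==-≡ q) ne

  entries : Relation → ℕ
  entries R = ∑ λ i → ∑ λ u → 𝟙 (R i u)

  delete-< : ∀ i u R → R i u ≡ true → entries (delete i u R) < entries R
  delete-< i u R Riu =
    ∑-mono-< (λ l → ∑-mono-≤ λ v → 𝟙-mono (delete-⊆ i u R)) i
      (∑-mono-< (λ v → 𝟙-mono (delete-⊆ i u R)) u
        (subst₂ (λ a b → 𝟙 a < 𝟙 b) (sym gone) (sym Riu) (s≤s z≤n)))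
    where
    gone : delete i u R i u ≡ false
    gone = trans (cong₂ (λ a b → R i u ∧ not (a ∧ b)) (==-refl i) (==-refl u)) (Bool.∧-zeroʳ _)

  -- Rado: if deleting (i , u₁) and deleting (i , u₂) both break the condition,
  -- submodularity of the capacity of neighbourhoods breaks it already for R.
  rado : ∀ R → HallCondition R → ∀ i {u₁ u₂} → ¬ u₁ ≡ u₂ →
         ∀ {Y₁ Y₂} → Violates (delete i u₁ R) Y₁ → ¬ Violates (delete i u₂ R) Y₂
  rado R hall i {u₁} {u₂} u₁≢u₂ {Y₁} {Y₂} v₁ v₂ = <-irrefl refl (begin-strict
    wt c N∪ + wt c N∩                    ≡⟨ ∑-distrib-+ _ _ ⟨
    ∑ (λ u → c u * 𝟙 (N∪ u) + c u * 𝟙 (N∩ u))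
                                         ≤⟨ ∑-mono-≤ submodular ⟩
    ∑ (λ u → c u * 𝟙 (N₁ u) + c u * 𝟙 (N₂ u))
                                         ≡⟨ ∑-distrib-+ _ _ ⟩
    wt c N₁ + wt c N₂                    <⟨ n<1+n _ ⟩
    -- Two strict violations gain 2, while leaving `i` out of `Y∩` costs `r i ≤ 1`; a strict
    -- inequality remains.
    suc (wt c N₁ + wt c N₂)              ≤⟨ ≤-pred (begin
      suc (suc (wt c N₁ + wt c N₂))        ≡⟨ cong suc (+-suc (wt c N₁) (wt c N₂)) ⟨
      suc (wt c N₁) + suc (wt c N₂)        ≤⟨ +-mono-≤ v₁ v₂ ⟩
      wt r Y₁ + wt r Y₂                    ≡⟨ ∑-distrib-+ _ _ ⟨
      ∑ (λ l → r l * 𝟙 (Y₁ l) + r l * 𝟙 (Y₂ l))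
                                           ≤⟨ ∑-mono-≤ modular ⟩
      ∑ (λ l → r l * 𝟙 (l == i) + (r l * 𝟙 (Y∪ l) + r l * 𝟙 (Y∩ l)))
                                           ≡⟨ ∑-distrib-+ _ _ ⟩
      wt r (_== i) + ∑ (λ l → r l * 𝟙 (Y∪ l) + r l * 𝟙 (Y∩ l))
                                           ≡⟨ cong₂ _+_ (∑-δ r i) (∑-distrib-+ _ _) ⟩
      r i + (wt r Y∪ + wt r Y∩)            ≤⟨ +-mono-≤ (r≤1 i) (+-mono-≤ (hall Y∪) (hall Y∩)) ⟩
      suc (wt c N∪ + wt c N∩)              ∎) ⟩
    wt c N∪ + wt c N∩                    ∎)
    where
    open ≤-Reasoning
    R₁ = delete i u₁ R
    R₂ = delete i u₂ R
    Y∪ Y∩ : Fin m → Bool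
    Y∪ l = Y₁ l ∨ Y₂ l
    -- `i` is left out because an edge at `i` may be missing from `R₁` or `R₂`, and the
    -- neighbourhood of `Y∩` has to lie in both `N₁` and `N₂`.
    Y∩ l = (Y₁ l ∧ Y₂ l) ∧ not (l == i)
    N∪ N∩ N₁ N₂ : Fin n → Bool
    N∪ = anyOf Y∪ R
    N∩ = anyOf Y∩ R
    N₁ = anyOf Y₁ R₁
    N₂ = anyOf Y₂ R₂
    -- If `i` were not in `Y`, the deletion would not affect the neighbourhood of `Y`, and `hall Y`
    -- would exclude the violation.
    member : ∀ {u Y} → Violates (delete i u R) Y → Y i ≡ true
    member {u} {Y} v with Y i in Yi
    ... | true  = refl
    ... | false = contradiction (≤-trans (hall Y) (wt-mono c _ _ keep)) (<⇒≱ v)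
      where
      keep : ∀ w → anyOf Y R w ≡ true → anyOf Y (delete i u R) w ≡ true
      keep w h with l , Yl , Rlw ← anyOf-elim Y R h =
        anyOf-intro Y (delete i u R) l Yl
          (delete-keep i u R Rlw λ { (refl , _) → true≢false Yl Yi })
    not-i : ∀ {l} → not (l == i) ≡ true → ¬ l ≡ i
    not-i h refl with () ← trans (sym h) (cong not (==-refl i))
    ∪⇒ : ∀ u → N∪ u ≡ true → N₁ u ≡ true ⊎ N₂ u ≡ true
    ∪⇒ u h with anyOf-elim Y∪ R h
    ... | l , Yl , Rlu with ≡-or-≢ l i
    ...   | inj₁ refl with ≡-or-≢ u u₁
    ...     | inj₂ u≢ = inj₁ (anyOf-intro Y₁ R₁ l (member v₁) (delete-keep i u₁ R Rlu λ (_ , e) → u≢ e))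
    ...     | inj₁ refl = inj₂ (anyOf-intro Y₂ R₂ l (member v₂) (delete-keep i u₂ R Rlu λ (_ , e) → u₁≢u₂ e))
    ∪⇒ u h | l , Yl , Rlu | inj₂ l≢ with ∨-true Yl
    ...     | inj₁ Y₁l = inj₁ (anyOf-intro Y₁ R₁ l Y₁l (delete-keep i u₁ R Rlu λ (e , _) → l≢ e))
    ...     | inj₂ Y₂l = inj₂ (anyOf-intro Y₂ R₂ l Y₂l (delete-keep i u₂ R Rlu λ (e , _) → l≢ e))
    ∩⇒ : ∀ u → N∩ u ≡ true → N₁ u ≡ true × N₂ u ≡ true
    ∩⇒ u h with l , Yl , Rlu ← anyOf-elim Y∩ R h
      with Y₁₂l , l≢ ← ∧-true Yl
      with Y₁l , Y₂l ← ∧-true Y₁₂l =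
        anyOf-intro Y₁ R₁ l Y₁l (delete-keep i u₁ R Rlu λ (e , _) → not-i l≢ e) ,
        anyOf-intro Y₂ R₂ l Y₂l (delete-keep i u₂ R Rlu λ (e , _) → not-i l≢ e)
    submodular : ∀ u → c u * 𝟙 (N∪ u) + c u * 𝟙 (N∩ u) ≤ c u * 𝟙 (N₁ u) + c u * 𝟙 (N₂ u)
    submodular u = subst₂ _≤_ (*-distribˡ-+ (c u) _ _) (*-distribˡ-+ (c u) _ _)
      (*-monoʳ-≤ (c u) (𝟙-pair (∪⇒ u) (inj₁ ∘ proj₁ ∘ ∩⇒ u) (λ _ → ∩⇒ u)))
    indicator : ∀ a b e → 𝟙 a + 𝟙 b ≤ 𝟙 e + (𝟙 (a ∨ b) + 𝟙 ((a ∧ b) ∧ not e))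
    indicator true  true  true  = ≤-refl
    indicator true  true  false = ≤-refl
    indicator true  false true  = s≤s z≤n
    indicator true  false false = ≤-refl
    indicator false true  true  = s≤s z≤n
    indicator false true  false = ≤-refl
    indicator false false _     = z≤n
    modular : ∀ l → r l * 𝟙 (Y₁ l) + r l * 𝟙 (Y₂ l) ≤
              r l * 𝟙 (l == i) + (r l * 𝟙 (Y∪ l) + r l * 𝟙 (Y∩ l))
    modular l = subst₂ _≤_ (*-distribˡ-+ (r l) _ _)
      (trans (*-distribˡ-+ (r l) _ _) (cong (r l * 𝟙 (l == i) +_) (*-distribˡ-+ (r l) _ _)))
      (*-monoʳ-≤ (r l) (indicator (Y₁ l) (Y₂ l) (l == i)))

  Functional : Relation → Set
  Functional R = ∀ i {u v} → R i u ≡ true → R i v ≡ true → u ≡ v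

  -- While some `i` has two images, `rado` allows one of the two edges to be deleted without losing
  -- Hall's condition. The number of edges bounds the recursion.
  prune : ∀ fuel R → entries R ≤ fuel → HallCondition R →
          ∃[ R′ ] (∀ i u → R′ i u ≡ true → R i u ≡ true) × HallCondition R′ × Functional R′
  prune fuel R bound hall with any? (λ i → any? λ u → any? λ v →
      (R i u Bool.≟ true) ×-dec ((R i v Bool.≟ true) ×-dec ¬? (u Fin.≟ v)))
  ... | no none = R , (λ _ _ h → h) , hall , unique
    where
    unique : Functional R
    unique i {u} {v} Riu Riv with u Fin.≟ v
    ... | yes u≡v = u≡v
    ... | no  u≢v = contradiction (i , u , v , Riu , Riv , u≢v) none
  ... | yes (i , u , v , Riu , Riv , u≢v) = delete-one fuel bound
    where
    recurse : ∀ fuel → entries R ≤ fuel → ∀ w → R i w ≡ true → HallCondition (delete i w R) →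
      ∃[ R′ ] (∀ i u → R′ i u ≡ true → R i u ≡ true) × HallCondition R′ × Functional R′
    recurse zero bound w Riw _ = contradiction (≤-trans (delete-< i w R Riw) bound) λ ()
    recurse (suc fuel) bound w Riw hall′
      with R′ , sub , hall″ , fun ← prune fuel (delete i w R)
             (≤-pred (≤-trans (delete-< i w R Riw) bound)) hall′
      = R′ , (λ l x h → delete-⊆ i w R (sub l x h)) , hall″ , fun
    delete-one : ∀ fuel → entries R ≤ fuel →
      ∃[ R′ ] (∀ i u → R′ i u ≡ true → R i u ≡ true) × HallCondition R′ × Functional R′
    delete-one fuel bound with violator? (delete i u R) | violator? (delete i v R)
    ... | inj₂ hall′    | _             = recurse fuel bound u Riu hall′
    ... | inj₁ _        | inj₂ hall′    = recurse fuel bound v Riv hall′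
    ... | inj₁ (_ , v₁) | inj₁ (_ , v₂) = contradiction v₂ (rado R hall i u≢v v₁)

  -- For functional `R′`, Hall's condition at the singleton of `i` yields an image of `i`. At the
  -- preimage of `u`, whose neighbourhood contains at most `u`, it is the capacity bound.
  assignment : ∀ R → HallCondition R →
    ∃[ R′ ] (∀ i u → R′ i u ≡ true → R i u ≡ true)
          × (∀ i → 1 ≤ r i → ∃[ u ] R′ i u ≡ true)
          × (∀ u → ∑ (λ i → r i * 𝟙 (R′ i u)) ≤ c u)
  assignment R hall with R′ , sub , hall′ , fun ← prune (entries R) R ≤-refl hall =
    R′ , sub , total , bounded
    where
    total : ∀ i → 1 ≤ r i → ∃[ u ] R′ i u ≡ true
    total i 1≤r with ∑-pos⇒∃ (λ u → c u * 𝟙 (anyOf (_== i) R′ u))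
                       (≤-trans (subst (1 ≤_) (sym (∑-δ r i)) 1≤r) (hall′ (_== i)))
    ... | u , pos with anyOf (_== i) R′ u in eq
    ...   | false = contradiction (subst (1 ≤_) (*-zeroʳ (c u)) pos) λ ()
    ...   | true with l , l≡i , Rlu ← anyOf-elim (_== i) R′ eq =
            u , subst (λ l → R′ l u ≡ true) (==-≡ l≡i) Rlu
    bounded : ∀ u → ∑ (λ i → r i * 𝟙 (R′ i u)) ≤ c u
    bounded u = begin
      wt r (λ i → R′ i u)                   ≤⟨ hall′ _ ⟩
      wt c (anyOf (λ i → R′ i u) R′)        ≤⟨ wt-mono c _ _ only ⟩
      wt c (_== u)                          ≡⟨ ∑-δ c u ⟩
      c u                                   ∎
      where
      open ≤-Reasoning
      only : ∀ v → anyOf (λ i → R′ i u) R′ v ≡ true → (v == u) ≡ true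
      only v h with i , Riu , Riv ← anyOf-elim (λ i → R′ i u) R′ h =
        dec-true (v Fin.≟ u) (fun i Riv Riu)

-- Realising a family of moves by a sequence of moves

afterMove-balance : ∀ {n} (φ : Pebbling n) {x y} → ¬ x ≡ y → 2 ≤ φ x → ∀ z →
                    afterMove φ x y z + 2 * 𝟙 (z == x) ≡ φ z + 𝟙 (z == y)
afterMove-balance φ {x} {y} x≢y 2≤φx z with z Fin.≟ x
... | yes refl with z Fin.≟ y
...   | yes z≡y = contradiction z≡y x≢y
...   | no  _   = trans (m∸n+n≡m 2≤φx) (sym (+-identityʳ _))
afterMove-balance φ {x} {y} x≢y 2≤φx z | no _ with z Fin.≟ y
...   | yes _ = trans (+-identityʳ _) (+-comm 1 (φ z))
...   | no  _ = refl

-- `f u w` counts the moves from `u` to `w`; these are the degrees in that directed multigraph.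
out inn : ∀ {n} → (Fin n → Fin n → ℕ) → Fin n → ℕ
out f u = ∑ λ w → f u w
inn f w = ∑ λ u → f u w

module Moves {n} (G : Graph n) where

  Supported : (Fin n → Fin n → ℕ) → Set
  Supported f = ∀ u w → 1 ≤ f u w → Adj G u w

  -- No order is imposed: a vertex may spend pebbles that it receives only through other moves of
  -- the family.
  Affordable : Pebbling n → (Fin n → Fin n → ℕ) → Set
  Affordable φ f = ∀ u → 2 * out f u ≤ φ u + inn f u

  -- An inequality, since moves that stay blocked are dropped; no vertex ends up with fewer pebbles
  -- than the whole family would leave there.
  Realised : Pebbling n → (Fin n → Fin n → ℕ) → Set
  Realised φ f = ∃[ ψ ] (Descendant G φ ψ × ∀ v → φ v + inn f v ≤ ψ v + 2 * out f v)

  -- If no move can be executed, every vertex u with out f u > 0 carries at most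
  -- one pebble, whence out f ≤ inn f; the totals agree, so out f = inn f.
  stuck-realised : ∀ φ f → Affordable φ f → (∀ u w → 1 ≤ f u w → φ u ≤ 1) → Realised φ f
  stuck-realised φ f aff light = φ , ε , λ v → +-monoʳ-≤ (φ v)
    (≤-trans (≤-reflexive (sym (≤∧∑≡⇒≡ out≤inn (∑-comm f) v))) (m≤m+n _ _))
    where
    out≤inn : ∀ u → out f u ≤ inn f u
    out≤inn u with out f u in eq
    ... | zero = z≤n
    ... | suc o with w , 1≤f ← ∑-pos⇒∃ (f u) (subst (1 ≤_) (sym eq) (s≤s z≤n)) =
      ≤-pred (begin
        suc (suc o)       ≤⟨ s≤s (m≤n+m _ o) ⟩
        suc o + suc o     ≡⟨ cong (suc o +_) (+-identityʳ _) ⟨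
        2 * suc o         ≡⟨ cong (2 *_) eq ⟨
        2 * out f u       ≤⟨ aff u ⟩
        φ u + inn f u     ≤⟨ +-monoˡ-≤ _ (light u w 1≤f) ⟩
        suc (inn f u)     ∎)
      where open ≤-Reasoning

  module Step (φ : Pebbling n) (f : Fin n → Fin n → ℕ) (aff : Affordable φ f)
              {u w} (u≢w : ¬ u ≡ w) (1≤f : 1 ≤ f u w) (2≤φ : 2 ≤ φ u) where

    φ′ : Pebbling n
    φ′ = afterMove φ u w

    δ : Fin n → Fin n → ℕ
    δ a b = 𝟙 (a == u) * 𝟙 (b == w)

    f′ : Fin n → Fin n → ℕ
    f′ a b = f a b ∸ δ a b

    f-split : ∀ a b → f a b ≡ f′ a b + δ a b
    f-split a b = sym (m∸n+n≡m δ≤f)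
      where
      δ≤f : δ a b ≤ f a b
      δ≤f with a Fin.≟ u | b Fin.≟ w
      ... | yes refl | yes refl = 1≤f
      ... | yes _    | no _     = z≤n
      ... | no _     | _        = z≤n

    out-split : ∀ a → out f a ≡ out f′ a + 𝟙 (a == u)
    out-split a = trans (∑-cong (f-split a)) (trans (∑-distrib-+ _ _)
      (cong (out f′ a +_) (∑-δ (λ _ → 𝟙 (a == u)) w)))

    inn-split : ∀ b → inn f b ≡ inn f′ b + 𝟙 (b == w)
    inn-split b = trans (∑-cong (λ a → f-split a b)) (trans (∑-distrib-+ _ _)
      (cong (inn f′ b +_) (trans (∑-cong λ a → *-comm (𝟙 (a == u)) _) (∑-δ (λ _ → 𝟙 (b == w)) u))))

    decreases : ∑ (out f′) < ∑ (out f)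
    decreases = ∑-mono-< (λ a → ≤-trans (m≤m+n _ _) (≤-reflexive (sym (out-split a)))) u
      (≤-reflexive (sym (trans (out-split u) (trans (cong (λ b → out f′ u + 𝟙 b) (==-refl u)) (+-comm _ 1)))))

    balance : ∀ z → φ z + inn f z ≡ 2 * 𝟙 (z == u) + (φ′ z + inn f′ z)
    balance z = begin
      φ z + inn f z                            ≡⟨ cong (φ z +_) (inn-split z) ⟩
      φ z + (inn f′ z + 𝟙 (z == w))            ≡⟨ shuffle₁ (φ z) (inn f′ z) (𝟙 (z == w)) ⟩
      (φ z + 𝟙 (z == w)) + inn f′ z            ≡⟨ cong (_+ inn f′ z) (afterMove-balance φ u≢w 2≤φ z) ⟨
      (φ′ z + 2 * 𝟙 (z == u)) + inn f′ z       ≡⟨ shuffle₂ (φ′ z) (2 * 𝟙 (z == u)) (inn f′ z) ⟩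
      2 * 𝟙 (z == u) + (φ′ z + inn f′ z)       ∎
      where
      open ≡-Reasoning
      shuffle₁ : ∀ a b c → a + (b + c) ≡ (a + c) + b
      shuffle₁ = solve-∀
      shuffle₂ : ∀ a b c → (a + b) + c ≡ b + (a + c)
      shuffle₂ = solve-∀

    double-out : ∀ z → 2 * out f z ≡ 2 * 𝟙 (z == u) + 2 * out f′ z
    double-out z = trans (cong (2 *_) (out-split z))
      (trans (*-distribˡ-+ 2 (out f′ z) _) (+-comm (2 * out f′ z) _))

    aff′ : Affordable φ′ f′
    aff′ z = +-cancelˡ-≤ (2 * 𝟙 (z == u)) _ _ (subst₂ _≤_ (double-out z) (balance z) (aff z))

    extend : Adj G u w → Realised φ′ f′ → Realised φ f
    extend adj (ψ , desc , ineq) =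
      ψ , move u w adj 2≤φ (λ _ → refl) ◅ desc , λ z → begin
        φ z + inn f z                               ≡⟨ balance z ⟩
        2 * 𝟙 (z == u) + (φ′ z + inn f′ z)          ≤⟨ +-monoʳ-≤ (2 * 𝟙 (z == u)) (ineq z) ⟩
        2 * 𝟙 (z == u) + (ψ z + 2 * out f′ z)       ≡⟨ shuffle (2 * 𝟙 (z == u)) (ψ z) _ ⟩
        ψ z + (2 * 𝟙 (z == u) + 2 * out f′ z)       ≡⟨ cong (ψ z +_) (double-out z) ⟨
        ψ z + 2 * out f z                           ∎
      where
      open ≤-Reasoning
      shuffle : ∀ a b c → a + (b + c) ≡ b + (a + c)
      shuffle = solve-∀

  adj⇒≢ : ∀ {u w} → Adj G u w → ¬ u ≡ w
  adj⇒≢ adj refl = irrefl G adj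

  -- Any move of the family whose source holds two pebbles can be made first: the remaining family
  -- is affordable from the new position. The induction is on the number of moves.
  realise : ∀ fuel φ f → ∑ (out f) ≤ fuel → Supported f → Affordable φ f → Realised φ f
  realise fuel φ f bound supp aff
    with any? (λ u → any? λ w → (1 ≤? f u w) ×-dec (2 ≤? φ u))
  ... | no none = stuck-realised φ f aff λ u w 1≤f → ≮⇒≥ λ 2≤φ → none (u , w , 1≤f , 2≤φ)
  realise zero φ f bound supp aff | yes (u , w , 1≤f , 2≤φ) =
    contradiction (≤-trans 1≤f (≤-trans (term≤∑ (f u) w) (≤-trans (term≤∑ (out f) u) bound))) λ ()
  realise (suc fuel) φ f bound supp aff | yes (u , w , 1≤f , 2≤φ) =
    extend (supp u w 1≤f)
      (realise fuel φ′ f′ (≤-pred (≤-trans decreases bound))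
        (λ a b 1≤f′ → supp a b (≤-trans 1≤f′ (m∸n≤m (f a b) (δ a b)))) aff′)
    where open Step φ f aff (adj⇒≢ (supp u w 1≤f)) 1≤f 2≤φ

  along-walk : ∀ {P u v ℓ} → WalkIn G P u v ℓ → ∀ φ → 2 ^ ℓ ≤ φ u → CanPebble G φ v
  along-walk (here _) φ 1≤φ = φ , ε , 1≤φ
  along-walk {u = u} {ℓ = suc ℓ} (step {w = w} _ adj walk) φ enough =
    continue (realise _ φ f ≤-refl supp aff)
    where
    f : Fin n → Fin n → ℕ
    -- `2 ^ ℓ` moves along the first edge; they cost `2 ^ suc ℓ` pebbles, which `u` is assumed to
    -- hold.
    f a b = (2 ^ ℓ * 𝟙 (b == w)) * 𝟙 (a == u)
    out-f : ∀ a → out f a ≡ 2 ^ ℓ * 𝟙 (a == u)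
    out-f a = trans (sym (*-distribʳ-∑ _ _)) (cong (_* 𝟙 (a == u)) (∑-δ (λ _ → 2 ^ ℓ) w))
    inn-f : ∀ b → inn f b ≡ 2 ^ ℓ * 𝟙 (b == w)
    inn-f b = ∑-δ (λ _ → 2 ^ ℓ * 𝟙 (b == w)) u
    supp : Supported f
    supp a b 1≤f with b Fin.≟ w
    ... | no _ = contradiction (subst (λ x → 1 ≤ x * 𝟙 (a == u)) (*-zeroʳ (2 ^ ℓ)) 1≤f) λ ()
    ... | yes refl with a Fin.≟ u
    ...   | yes refl = adj
    ...   | no _     = contradiction (subst (1 ≤_) (*-zeroʳ (2 ^ ℓ * 1)) 1≤f) λ ()
    aff : Affordable φ f
    aff a with ≡-or-≢ a u
    ... | inj₁ refl = ≤-trans (≤-reflexive (cong (2 *_)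
          (trans (out-f a) (trans (cong (λ b → 2 ^ ℓ * 𝟙 b) (==-refl a)) (*-identityʳ (2 ^ ℓ))))))
          (≤-trans enough (m≤m+n _ _))
    ... | inj₂ a≢u = ≤-trans (≤-reflexive (cong (2 *_)
          (trans (out-f a) (trans (cong (λ b → 2 ^ ℓ * 𝟙 b) (dec-false (a Fin.≟ u) a≢u)) (*-zeroʳ (2 ^ ℓ)))))) z≤n
    arrived : ∀ {x} → φ w + inn f w ≤ x + 2 * out f w → 2 ^ ℓ ≤ x
    arrived {x} ineq = begin
      2 ^ ℓ              ≡⟨ *-identityʳ _ ⟨
      2 ^ ℓ * 1          ≡⟨ cong (λ b → 2 ^ ℓ * 𝟙 b) (==-refl w) ⟨
      2 ^ ℓ * 𝟙 (w == w) ≡⟨ inn-f w ⟨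
      inn f w            ≤⟨ m≤n+m _ (φ w) ⟩
      φ w + inn f w      ≤⟨ ineq ⟩
      x + 2 * out f w    ≡⟨ cong (λ y → x + 2 * y) (out-f w) ⟩
      x + 2 * (2 ^ ℓ * 𝟙 (w == u))
        ≡⟨ cong (λ b → x + 2 * (2 ^ ℓ * 𝟙 b)) (dec-false (w Fin.≟ u) λ { refl → irrefl G adj }) ⟩
      x + 2 * (2 ^ ℓ * 0) ≡⟨ cong (λ y → x + 2 * y) (*-zeroʳ (2 ^ ℓ)) ⟩
      x + 0              ≡⟨ +-identityʳ x ⟩
      x                  ∎
      where open ≤-Reasoning
    continue : Realised φ f → CanPebble G φ _
    continue (ψ , desc , ineq) with χ , desc′ , 1≤χ ← along-walk walk ψ (arrived (ineq w)) =
      χ , desc ◅◅ desc′ , 1≤χ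

-- Collecting pebbles on one vertex

-- How many pebbles the vertex can send on. A single pebble counts because, paired with a received
-- one, it pays for one move.
cap : ℕ → ℕ
cap 0 = 0
cap 1 = 1
cap (suc (suc p)) = suc ⌊ p /2⌋

double-half : ∀ p → 2 * ⌊ p /2⌋ ≤ p
double-half p = begin
  ⌊ p /2⌋ + (⌊ p /2⌋ + 0)  ≡⟨ cong (⌊ p /2⌋ +_) (+-identityʳ _) ⟩
  ⌊ p /2⌋ + ⌊ p /2⌋        ≤⟨ +-monoʳ-≤ ⌊ p /2⌋ (⌊n/2⌋≤⌈n/2⌉ p) ⟩
  _                        ≡⟨ ⌊n/2⌋+⌈n/2⌉≡n p ⟩
  p                        ∎
  where open ≤-Reasoning

double-cap : ∀ p → ¬ p ≡ 1 → 2 * cap p ≤ p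
double-cap 0 _ = z≤n
double-cap 1 p≢1 = contradiction refl p≢1
double-cap (suc (suc p)) _ = ≤-trans (≤-reflexive (*-distribˡ-+ 2 1 ⌊ p /2⌋)) (s≤s (s≤s (double-half p)))

module Collect {n} (G : Graph n) (adj? : ∀ x y → Dec (Adj G x y)) where

  open Moves G

  opaque
    N : (Fin n → Bool) → Fin n → Bool
    N A x = not (A x) ∧ does (any? λ y → (A y Bool.≟ true) ×-dec adj? y x)

    N-intro : ∀ A {x} y → A y ≡ true → Adj G y x → A x ≡ false → N A x ≡ true
    N-intro A y Ay adj Ax = cong₂ _∧_ (cong not Ax) (dec-true (any? _) (y , Ay , adj))

    N-outside : ∀ A {x} → N A x ≡ true → A x ≡ false
    N-outside A {x} h with A x | h
    ... | false | _ = refl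

    N-adj : ∀ A {x} → N A x ≡ true → ∃[ y ] A y ≡ true × Adj G y x
    N-adj A h = does-true (any? _) (proj₂ (∧-true {a = not (A _)} h))

  record Cut (φ : Pebbling n) (v : Fin n) (j : ℕ) (A : Fin n → Bool) : Set where
    field
      root  : A v ≡ true
      ones  : ∀ {u} → A u ≡ true → ¬ u ≡ v → φ u ≡ 1
      small : wt (cap ∘ φ) (N A) < j

  Collects : Pebbling n → Fin n → ℕ → Set
  Collects φ v j = ∃[ ψ ] (Descendant G φ ψ × φ v + j ≤ ψ v)

  module Menger (φ : Pebbling n) (v : Fin n) (j : ℕ) where

    -- The possible relays: holding one pebble, they must receive one before they can send one.
    interior : Fin n → Bool
    interior w = not (w == v) ∧ does (φ w ≟ 1)

    interior-≢ : ∀ {w} → interior w ≡ true → ¬ w ≡ v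
    interior-≢ {w} h refl with () ← trans (sym (proj₁ (∧-true h))) (cong not (==-refl w))

    interior-1 : ∀ {w} → interior w ≡ true → φ w ≡ 1
    interior-1 {w} h = does-true (φ w ≟ 1) (proj₂ (∧-true {a = not (w == v)} h))

    interior-intro : ∀ {w} → ¬ w ≡ v → φ w ≡ 1 → interior w ≡ true
    interior-intro {w} w≢v φw = cong₂ _∧_ (cong not (dec-false (w Fin.≟ v) w≢v)) (dec-true (φ w ≟ 1) φw)

    -- Zero at `v`, so that no pebble leaves the collecting vertex.
    capacity : Fin n → ℕ
    capacity u = cap (φ u) * 𝟙 (not (u == v))

    capacity-v : capacity v ≡ 0
    capacity-v = trans (cong (λ b → cap (φ v) * 𝟙 (not b)) (==-refl v)) (*-zeroʳ (cap (φ v)))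

    capacity-≢ : ∀ {u} → ¬ u ≡ v → capacity u ≡ cap (φ u)
    capacity-≢ {u} u≢v =
      trans (cong (λ b → cap (φ u) * 𝟙 (not b)) (dec-false (u Fin.≟ v) u≢v)) (*-identityʳ _)

    -- P w u: the pebble passing through w comes from u (w is unused if u = w);
    -- Q i u: the i-th pebble collected at v comes from u.
    module Routing (P : Fin n → Fin n → Bool) (Q : Fin j → Fin n → Bool)
      (P-adj : ∀ w u → P w u ≡ true → u ≡ w ⊎ Adj G u w)
      (Q-adj : ∀ i u → Q i u ≡ true → Adj G u v)
      (P-total : ∀ w → interior w ≡ true → ∃[ u ] P w u ≡ true)
      (Q-total : ∀ i → ∃[ u ] Q i u ≡ true)
      (bounded : ∀ u → ∑ (λ w → 𝟙 (P w u)) + ∑ (λ i → 𝟙 (Q i u)) ≤ capacity u)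
      where

      p : Fin n → Fin n → ℕ
      p u w = 𝟙 (P w u ∧ not (w == u))

      q : Fin n → ℕ
      q u = ∑ λ i → 𝟙 (Q i u)

      f : Fin n → Fin n → ℕ
      f u w = p u w + q u * 𝟙 (w == v)

      supp : Supported f
      supp u w 1≤f with P w u ∧ not (w == u) in eq
      ... | true with Pwu , u≢w ← ∧-true {a = P w u} eq with P-adj w u Pwu
      ...   | inj₂ adj = adj
      ...   | inj₁ refl with () ← trans (sym u≢w) (cong not (==-refl w))
      supp u w 1≤f | false with w Fin.≟ v
      ...   | no _ = contradiction (subst (1 ≤_) (*-zeroʳ (q u)) 1≤f) λ ()
      ...   | yes refl with i , Qiu ← ∑-pos⇒∃ (λ i → 𝟙 (Q i u)) (subst (1 ≤_) (*-identityʳ (q u)) 1≤f) =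
              Q-adj i u (𝟙-true Qiu)

      out-f : ∀ u → out f u ≡ ∑ (p u) + q u
      out-f u = trans (∑-distrib-+ (p u) _) (cong (∑ (p u) +_) (∑-δ (λ _ → q u) v))

      -- A vertex that chooses itself uses up one unit of its capacity without making a move; with
      -- capacity 1 it then sends nothing.
      out-bound : ∀ u → out f u + 𝟙 (P u u) ≤ capacity u
      out-bound u = begin
        out f u + 𝟙 (P u u)                        ≡⟨ cong (_+ 𝟙 (P u u)) (out-f u) ⟩
        ∑ (p u) + q u + 𝟙 (P u u)                  ≡⟨ shuffle (∑ (p u)) (q u) (𝟙 (P u u)) ⟩
        ∑ (p u) + 𝟙 (P u u) + q u
          ≡⟨ cong (λ x → ∑ (p u) + x + q u) (∑-δ (λ w → 𝟙 (P w u)) u) ⟨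
        ∑ (p u) + ∑ (λ w → 𝟙 (P w u) * 𝟙 (w == u)) + q u
          ≡⟨ cong (_+ q u) (∑-distrib-+ (p u) _) ⟨
        ∑ (λ w → p u w + 𝟙 (P w u) * 𝟙 (w == u)) + q u
          ≤⟨ +-monoˡ-≤ (q u) (∑-mono-≤ λ w → merge (P w u) (w == u)) ⟩
        ∑ (λ w → 𝟙 (P w u)) + q u                  ≤⟨ bounded u ⟩
        capacity u                                 ∎
        where
        open ≤-Reasoning
        shuffle : ∀ a b c → a + b + c ≡ a + c + b
        shuffle = solve-∀
        merge : ∀ a b → 𝟙 (a ∧ not b) + 𝟙 a * 𝟙 b ≤ 𝟙 a
        merge false b     = z≤n
        merge true  false = ≤-refl
        merge true  true  = ≤-refl

      idle : ∀ {u} → capacity u ≡ 0 → out f u ≡ 0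
      idle {u} c≡0 = n≤0⇒n≡0 (≤-trans (m≤m+n _ _) (subst (out f u + 𝟙 (P u u) ≤_) c≡0 (out-bound u)))

      aff : Affordable φ f
      aff u with ≡-or-≢ u v
      ... | inj₁ refl = ≤-trans (≤-reflexive (cong (2 *_) (idle capacity-v))) z≤n
      ... | inj₂ u≢v with φ u ≟ 1
      ...   | no φ≢1 = begin
              2 * out f u      ≤⟨ *-monoʳ-≤ 2 (m≤m+n (out f u) _) ⟩
              2 * (out f u + 𝟙 (P u u)) ≤⟨ *-monoʳ-≤ 2 (out-bound u) ⟩
              2 * capacity u   ≡⟨ cong (2 *_) (capacity-≢ u≢v) ⟩
              2 * cap (φ u)    ≤⟨ double-cap (φ u) φ≢1 ⟩
              φ u              ≤⟨ m≤m+n _ _ ⟩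
              φ u + inn f u    ∎
              where open ≤-Reasoning
      -- With one pebble, `u` either chose itself and stays idle, or receives a pebble from `a`
      -- which, together with its own, pays for its only move.
      ...   | yes φ≡1 with P-total u (interior-intro u≢v φ≡1)
      ...     | a , Pua with ≡-or-≢ u a
      ...       | inj₁ refl = ≤-trans (≤-reflexive (cong (2 *_) out≡0)) z≤n
                  where
                  out≡0 : out f u ≡ 0
                  out≡0 = n≤0⇒n≡0 (≤-pred (subst₂ _≤_
                    (trans (cong (λ b → out f u + 𝟙 b) Pua) (+-comm _ 1))
                    (trans (capacity-≢ u≢v) (cong cap φ≡1)) (out-bound u)))
      ...       | inj₂ u≢a = begin
                  2 * out f u      ≤⟨ *-monoʳ-≤ 2 out≤1 ⟩
                  1 + 1            ≤⟨ +-mono-≤ (≤-reflexive (sym φ≡1)) 1≤inn ⟩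
                  φ u + inn f u    ∎
                  where
                  open ≤-Reasoning
                  out≤1 : out f u ≤ 1
                  out≤1 = ≤-trans (m≤m+n _ _) (subst (out f u + 𝟙 (P u u) ≤_)
                    (trans (capacity-≢ u≢v) (cong cap φ≡1)) (out-bound u))
                  1≤inn : 1 ≤ inn f u
                  1≤inn = ≤-trans (≤-trans
                    (𝟙-pos (cong₂ _∧_ Pua (cong not (dec-false (u Fin.≟ a) u≢a)))) (m≤m+n _ _))
                    (term≤∑ (λ b → f b u) a)

      j≤inn : j ≤ inn f v
      j≤inn = begin
        j                               ≡⟨ ∑-one j ⟨
        ∑ {j} (λ _ → 1)                 ≤⟨ ∑-mono-≤ row ⟩
        ∑ (λ i → ∑ λ u → 𝟙 (Q i u))     ≡⟨ ∑-comm (λ i u → 𝟙 (Q i u)) ⟩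
        ∑ q                             ≤⟨ ∑-mono-≤ delivered ⟩
        inn f v                         ∎
        where
        open ≤-Reasoning
        delivered : ∀ u → q u ≤ f u v
        delivered u = begin
          q u                        ≡⟨ *-identityʳ (q u) ⟨
          q u * 1                    ≡⟨ cong (λ b → q u * 𝟙 b) (==-refl v) ⟨
          q u * 𝟙 (v == v)           ≤⟨ m≤n+m _ (p u v) ⟩
          f u v                      ∎
        row : ∀ i → 1 ≤ ∑ λ u → 𝟙 (Q i u)
        row i with u , Qiu ← Q-total i = ≤-trans (𝟙-pos Qiu) (term≤∑ (λ u → 𝟙 (Q i u)) u)

      collects : Collects φ v j
      collects with ψ , desc , ineq ← realise _ φ f ≤-refl supp aff = ψ , desc , (begin
        φ v + j              ≤⟨ +-monoʳ-≤ (φ v) j≤inn ⟩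
        φ v + inn f v        ≤⟨ ineq v ⟩
        ψ v + 2 * out f v    ≡⟨ cong (λ x → ψ v + 2 * x) (idle capacity-v) ⟩
        ψ v + 0              ≡⟨ +-identityʳ _ ⟩
        ψ v                  ∎)
        where open ≤-Reasoning

    -- A linking problem as a bipartite assignment: every interior vertex, and each of the `j`
    -- pebbles wanted at `v`, asks for a source. The remaining vertices are listed with demand 0.
    demand⁺ : Fin n ⊎ Fin j → ℕ
    demand⁺ = [ 𝟙 ∘ interior , (λ _ → 1) ]′

    R⁺ : Fin n ⊎ Fin j → Fin n → Bool
    R⁺ (inj₁ w) u = interior w ∧ ((u == w) ∨ does (adj? u w))
    R⁺ (inj₂ _) u = does (adj? u v)

    demand : Fin (n + j) → ℕ
    demand i = demand⁺ (splitAt n i)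

    R : Fin (n + j) → Fin n → Bool
    R i = R⁺ (splitAt n i)

    demand≤1 : ∀ i → demand i ≤ 1
    demand≤1 i with splitAt n i
    ... | inj₁ w = 𝟙≤1 (interior w)
    ... | inj₂ _ = ≤-refl

    demandˡ : ∀ w → demand (w ↑ˡ j) ≡ 𝟙 (interior w)
    demandˡ w = cong demand⁺ (splitAt-↑ˡ n w j)

    demandʳ : ∀ i → demand (n ↑ʳ i) ≡ 1
    demandʳ i = cong demand⁺ (splitAt-↑ʳ n j i)

    Rˡ : ∀ w u → R (w ↑ˡ j) u ≡ interior w ∧ ((u == w) ∨ does (adj? u w))
    Rˡ w u = cong (λ s → R⁺ s u) (splitAt-↑ˡ n w j)

    Rʳ : ∀ i u → R (n ↑ʳ i) u ≡ does (adj? u v)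
    Rʳ i u = cong (λ s → R⁺ s u) (splitAt-↑ʳ n j i)

    open Hall demand demand≤1 capacity

    route : HallCondition R → Collects φ v j
    route hall with R′ , sub , total , bound ← assignment R hall = Routing.collects
      (λ w → R′ (w ↑ˡ j)) (λ i → R′ (n ↑ʳ i)) P-adj
      (λ i u h → does-true (adj? u v) (trans (sym (Rʳ i u)) (sub _ _ h)))
      (λ w int → total (w ↑ˡ j) (subst (1 ≤_) (sym (demandˡ w)) (𝟙-pos int)))
      (λ i → total (n ↑ʳ i) (≤-reflexive (sym (demandʳ i))))
      (λ u → ≤-trans (split u) (bound u))
      where
      P-int : ∀ w u → R′ (w ↑ˡ j) u ≡ true → interior w ≡ true × ((u == w) ∨ does (adj? u w)) ≡ true
      P-int w u h = ∧-true (trans (sym (Rˡ w u)) (sub _ _ h))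
      P-adj : ∀ w u → R′ (w ↑ˡ j) u ≡ true → u ≡ w ⊎ Adj G u w
      P-adj w u h with ∨-true {a = u == w} (proj₂ (P-int w u h))
      ... | inj₁ e = inj₁ (==-≡ e)
      ... | inj₂ a = inj₂ (does-true (adj? u w) a)
      split : ∀ u → ∑ (λ w → 𝟙 (R′ (w ↑ˡ j) u)) + ∑ (λ i → 𝟙 (R′ (n ↑ʳ i) u)) ≤
                    ∑ λ i → demand i * 𝟙 (R′ i u)
      split u = ≤-trans (+-mono-≤ (∑-mono-≤ left) (∑-mono-≤ right)) (≤-reflexive (sym (∑-++ n _)))
        where
        left : ∀ w → 𝟙 (R′ (w ↑ˡ j) u) ≤ demand (w ↑ˡ j) * 𝟙 (R′ (w ↑ˡ j) u)
        left w with R′ (w ↑ˡ j) u in eq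
        ... | false = z≤n
        ... | true  = ≤-reflexive (sym (trans (*-identityʳ _)
                        (trans (demandˡ w) (cong 𝟙 (proj₁ (P-int w u eq))))))
        right : ∀ i → 𝟙 (R′ (n ↑ʳ i) u) ≤ demand (n ↑ʳ i) * 𝟙 (R′ (n ↑ʳ i) u)
        right i = ≤-reflexive (sym (trans (cong (_* 𝟙 (R′ (n ↑ʳ i) u)) (demandʳ i)) (*-identityˡ _)))

    -- The neighbourhood of `Y` contains `I`, where each vertex has load 1, and the disjoint
    -- boundary `N A`. The size of `I` cancels in the violated inequality, which leaves `N A` with
    -- capacity less than `j`.
    module FromViolator (Y : Fin (n + j) → Bool) (viol : Violates R Y) where

      I A NY : Fin n → Bool
      I u = interior u ∧ Y (u ↑ˡ j)
      A u = (u == v) ∨ I u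
      NY = anyOf Y R

      load : Fin n → ℕ
      load x = capacity x * 𝟙 (NY x)

      self : ∀ {x} → I x ≡ true → load x ≡ 1
      self {x} Ix with int , Yx ← ∧-true {a = interior x} Ix = cong₂ _*_
        (trans (capacity-≢ (interior-≢ int)) (cong cap (interior-1 int)))
        (cong 𝟙 (anyOf-intro Y R (x ↑ˡ j) Yx
          (trans (Rˡ x x) (cong₂ _∧_ int (cong (_∨ does (adj? x x)) (==-refl x))))))

      A-v : A v ≡ true
      A-v = cong (_∨ I v) (==-refl v)

      A-≢ : ∀ {u} → A u ≡ true → ¬ u ≡ v → I u ≡ true
      A-≢ {u} Au u≢v with ∨-true {a = u == v} Au
      ... | inj₁ e  = contradiction (==-≡ e) u≢v
      ... | inj₂ Iu = Iu

      weight-Y : wt demand Y ≡ ∑ (λ w → 𝟙 (I w)) + ∑ (λ i → 𝟙 (Y (n ↑ʳ i)))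
      weight-Y = trans (∑-++ n _) (cong₂ _+_
        (∑-cong λ w → trans (cong (_* 𝟙 (Y (w ↑ˡ j))) (demandˡ w)) (mult (interior w) _))
        (∑-cong λ i → trans (cong (_* 𝟙 (Y (n ↑ʳ i))) (demandʳ i)) (*-identityˡ _)))
        where
        mult : ∀ a b → 𝟙 a * 𝟙 b ≡ 𝟙 (a ∧ b)
        mult false b = refl
        mult true  b = *-identityˡ _

      -- Otherwise `Y` would demand only the size of `I`, which `I` itself supplies. This puts the
      -- neighbours of `v` into `NY`.
      target-in-Y : ∃[ i ] Y (n ↑ʳ i) ≡ true
      target-in-Y with any? (λ i → Y (n ↑ʳ i) Bool.≟ true)
      ... | yes found = found
      ... | no none = contradiction (begin
        wt demand Y                                          ≡⟨ weight-Y ⟩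
        ∑ (λ w → 𝟙 (I w)) + ∑ (λ i → 𝟙 (Y (n ↑ʳ i)))
          ≡⟨ cong (∑ (λ w → 𝟙 (I w)) +_) (∑-zero _ λ i → cong 𝟙 (≢true⇒false λ h → none (i , h))) ⟩
        ∑ (λ w → 𝟙 (I w)) + 0                                ≡⟨ +-identityʳ _ ⟩
        ∑ (λ w → 𝟙 (I w))                                    ≤⟨ ∑-mono-≤ below ⟩
        ∑ load                                               ∎) (<⇒≱ viol)
        where
        open ≤-Reasoning
        below : ∀ w → 𝟙 (I w) ≤ load w
        below w with I w in eq
        ... | false = z≤n
        ... | true  = ≤-reflexive (sym (self eq))

      absorbed : ∀ {x} → N A x ≡ true → NY x ≡ true
      absorbed {x} h with y , Ay , adj ← N-adj A h with ≡-or-≢ y v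
      ... | inj₁ refl with i , Yi ← target-in-Y =
            anyOf-intro Y R (n ↑ʳ i) Yi (trans (Rʳ i x) (dec-true (adj? x y) (symm G adj)))
      ... | inj₂ y≢v with int , Yy ← ∧-true {a = interior y} (A-≢ Ay y≢v) =
            anyOf-intro Y R (y ↑ˡ j) Yy
              (trans (Rˡ y x) (cong₂ _∧_ int (∨-trueʳ {a = x == y} (dec-true (adj? x y) (symm G adj)))))

      pointwise : ∀ x → 𝟙 (I x) + cap (φ x) * 𝟙 (N A x) ≤ load x
      pointwise x with I x in eqI | N A x in eqN
      ... | true | true = ⊥-elim (true≢false (∨-trueʳ {a = x == v} eqI) (N-outside A eqN))
      ... | true | false = ≤-reflexive (trans (cong suc (*-zeroʳ (cap (φ x)))) (sym (self eqI)))
      ... | false | false = ≤-trans (≤-reflexive (*-zeroʳ (cap (φ x)))) z≤n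
      ... | false | true = ≤-reflexive (cong₂ _*_ (sym (capacity-≢ x≢v)) (cong 𝟙 (sym (absorbed eqN))))
        where
        x≢v : ¬ x ≡ v
        x≢v refl = true≢false A-v (N-outside A eqN)

      cut : Cut φ v j A
      cut = record
        { root  = A-v
        ; ones  = λ {u} Au u≢v → interior-1 (proj₁ (∧-true {a = interior u} (A-≢ Au u≢v)))
        ; small = +-cancelˡ-< (∑ (λ w → 𝟙 (I w))) _ _ (begin-strict
            ∑ (λ w → 𝟙 (I w)) + wt (cap ∘ φ) (N A)          ≡⟨ ∑-distrib-+ _ _ ⟨
            ∑ (λ w → 𝟙 (I w) + cap (φ w) * 𝟙 (N A w))       ≤⟨ ∑-mono-≤ pointwise ⟩
            ∑ load                                           <⟨ viol ⟩
            wt demand Y                                      ≡⟨ weight-Y ⟩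
            ∑ (λ w → 𝟙 (I w)) + ∑ (λ i → 𝟙 (Y (n ↑ʳ i)))
              ≤⟨ +-monoʳ-≤ _ (≤-trans (∑-mono-≤ λ i → 𝟙≤1 (Y (n ↑ʳ i))) (≤-reflexive (∑-one j))) ⟩
            ∑ (λ w → 𝟙 (I w)) + j                            ∎)
        }
        where open ≤-Reasoning

    menger : Collects φ v j ⊎ ∃ (Cut φ v j)
    menger with violator? R
    ... | inj₂ hall       = inj₁ (route hall)
    ... | inj₁ (Y , viol) = inj₂ (_ , FromViolator.cut Y viol)

  open Menger public using (menger)

-- Minimal cuts and the counting argument

_∖_ : ∀ {n} → (Fin n → Bool) → (Fin n → Bool) → Fin n → Bool
(A ∖ B) u = A u ∧ not (B u)

∖-intro : ∀ {n} (A B : Fin n → Bool) {u} → A u ≡ true → B u ≡ false → (A ∖ B) u ≡ true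
∖-intro A B Au Bu = cong₂ (λ a b → a ∧ not b) Au Bu

∖-elim : ∀ {n} (A B : Fin n → Bool) {u} → (A ∖ B) u ≡ true → A u ≡ true × B u ≡ false
∖-elim A B {u} h with A u | B u | h
... | true | false | _ = refl , refl

∖-gone : ∀ {n} (A B : Fin n → Bool) {u} → B u ≡ true → (A ∖ B) u ≡ false
∖-gone A B {u} Bu = trans (cong (λ b → A u ∧ not b) Bu) (Bool.∧-zeroʳ (A u))

module Counting {n} (G : Graph n) (adj? : ∀ x y → Dec (Adj G x y)) (φ : Pebbling n) where

  open Collect G adj?

  c : Fin n → ℕ
  c u = cap (φ u)

  Rooted : Fin n → (Fin n → Bool) → Set
  Rooted v A = A v ≡ true × (∀ u → A u ≡ true → ¬ u ≡ v → φ u ≡ 1)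

  -- Lexicographic measure: first the capacity of N A, then the size of A.
  cost : (Fin n → Bool) → Fin n → ℕ
  cost A x = suc n * c x * 𝟙 (N A x) + 𝟙 (A x)

  g : (Fin n → Bool) → ℕ
  g A = ∑ (cost A)

  cost-mono : ∀ A B x → (N A x ≡ true → N B x ≡ true) → (A x ≡ true → B x ≡ true) → cost A x ≤ cost B x
  cost-mono A B x N⊆ A⊆ = +-mono-≤ (*-monoʳ-≤ (suc n * c x) (𝟙-mono N⊆)) (𝟙-mono A⊆)

  g-cong-≤ : ∀ A B → A ≗ B → g A ≤ g B
  g-cong-≤ A B A≗B = ∑-mono-≤ λ x → cost-mono A B x
    (λ h → let y , Ay , adj = N-adj A h in
      N-intro B y (trans (sym (A≗B y)) Ay) adj (trans (sym (A≗B x)) (N-outside A h)))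
    (trans (sym (A≗B x)))

  Minimal : Fin n → (Fin n → Bool) → Set
  Minimal v A = ∀ B → Rooted v B → g A ≤ g B

  rooted? : ∀ v A → Dec (Rooted v A)
  rooted? v A = (A v Bool.≟ true) ×-dec
    all? λ u → (A u Bool.≟ true) →-dec (¬? (u Fin.≟ v) →-dec (φ u ≟ 1))

  minimise : ∀ fuel v A → g A ≤ fuel → Rooted v A →
             ∃[ B ] Rooted v B × Minimal v B × g B ≤ g A
  minimise fuel v A bound rooted
    with search (λ B → rooted? v B ×-dec (g B <? g A))
      (λ {B} {B′} eq (r , lt) →
        (trans (sym (eq v)) (proj₁ r) , λ u B′u → proj₂ r u (trans (eq u) B′u)) ,
        ≤-<-trans (g-cong-≤ B′ B (λ i → sym (eq i))) lt)
  ... | no none = A , rooted , (λ B r → ≮⇒≥ λ lt → none (B , r , lt)) , ≤-refl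
  minimise zero v A bound rooted | yes (B , r , lt) = contradiction (≤-trans lt bound) λ ()
  minimise (suc fuel) v A bound rooted | yes (B , r , lt)
    with C , rC , min , le ← minimise fuel v B (≤-pred (≤-trans lt bound)) r
    = C , rC , min , ≤-trans le (<⇒≤ lt)

  g-split : ∀ A → g A ≡ suc n * wt c (N A) + ∑ (λ x → 𝟙 (A x))
  g-split A = trans (∑-distrib-+ _ _) (cong (_+ ∑ (λ x → 𝟙 (A x)))
    (trans (∑-cong λ x → *-assoc (suc n) (c x) _) (sym (*-distribˡ-∑ (suc n) _))))

  record MinimalCut (v : Fin n) (t : ℕ) (A : Fin n → Bool) : Set where
    field
      rooted  : Rooted v A
      minimal : Minimal v A
      small   : wt c (N A) < t

  -- Minimising `g` keeps the capacity bound: the size term is at most `n`, less than the weight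
  -- `suc n` of one unit of capacity.
  minimalCut : ∀ {v t} → ∃ (Cut φ v t) → ∃ (MinimalCut v t)
  minimalCut {v} {t} (A , cut)
    with B , r , min , le ← minimise (g A) v A ≤-refl (Cut.root cut , λ _ → Cut.ones cut)
    = B , record { rooted = r ; minimal = min ; small = *-cancelˡ-< (suc n) _ _ (begin-strict
        suc n * wt c (N B)                              ≤⟨ m≤m+n _ _ ⟩
        suc n * wt c (N B) + ∑ (λ x → 𝟙 (B x))          ≡⟨ g-split B ⟨
        g B                                             ≤⟨ le ⟩
        g A                                             ≡⟨ g-split A ⟩
        suc n * wt c (N A) + ∑ (λ x → 𝟙 (A x))
          ≤⟨ +-monoʳ-≤ (suc n * wt c (N A)) (≤-trans (∑-mono-≤ λ x → 𝟙≤1 (A x)) (≤-reflexive (∑-one n))) ⟩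
        suc n * wt c (N A) + n                          <⟨ +-monoʳ-< (suc n * wt c (N A)) (n<1+n n) ⟩
        suc n * wt c (N A) + suc n                      ≡⟨ +-comm _ (suc n) ⟩
        suc n + suc n * wt c (N A)                      ≡⟨ *-suc (suc n) (wt c (N A)) ⟨
        suc n * suc (wt c (N A))                        ≤⟨ *-monoʳ-≤ (suc n) (Cut.small cut) ⟩
        suc n * t                                       ∎) }
    where open ≤-Reasoning

  big : Fin n → Bool
  big u = does (2 ≤? φ u)

  zer : Fin n → Bool
  zer u = does (φ u ≟ 0)

  β ζ : Fin n → ℕ
  β u = c u * 𝟙 (big u)
  ζ u = 𝟙 (zer u)

  big-≥2 : ∀ {u} → big u ≡ true → 2 ≤ φ u
  big-≥2 {u} = does-true (2 ≤? φ u)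

  big⇒≢1 : ∀ {u} → big u ≡ true → ¬ φ u ≡ 1
  big⇒≢1 {u} h φ≡1 = contradiction (subst (2 ≤_) φ≡1 (big-≥2 h)) λ { (s≤s ()) }

  β≤c : ∀ u → β u ≤ c u
  β≤c u = ≤-trans (*-monoʳ-≤ (c u) (𝟙≤1 (big u))) (≤-reflexive (*-identityʳ _))

  excess : ∀ u → φ u + ζ u ≤ 1 + 2 * β u
  excess u with φ u
  ... | 0 = ≤-refl
  ... | 1 = ≤-refl
  ... | suc (suc p) = begin
    suc (suc p) + 0                     ≡⟨ +-identityʳ _ ⟩
    suc (suc p)                         ≡⟨ cong (2 +_) (⌊n/2⌋+⌈n/2⌉≡n p) ⟨
    suc (suc (⌊ p /2⌋ + ⌊ suc p /2⌋))   ≤⟨ s≤s (s≤s (+-monoʳ-≤ ⌊ p /2⌋ (half-suc p))) ⟩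
    suc (suc (⌊ p /2⌋ + suc ⌊ p /2⌋))   ≡⟨ rearrange ⌊ p /2⌋ ⟩
    1 + 2 * (suc ⌊ p /2⌋ * 1)           ∎
    where
    open ≤-Reasoning
    half-suc : ∀ p → ⌊ suc p /2⌋ ≤ suc ⌊ p /2⌋
    half-suc 0 = z≤n
    half-suc 1 = ≤-refl
    half-suc (suc (suc p)) = s≤s (half-suc p)
    rearrange : ∀ h → suc (suc (h + suc h)) ≡ 1 + 2 * (suc h * 1)
    rearrange = solve-∀

  -- With `n` pebbles on `n` vertices, every empty vertex is balanced by a surplus pebble on a
  -- vertex holding at least two, and the surplus there is at most `2 * β u`.
  zeros≤ : ∑ φ ≡ n → ∑ ζ ≤ 2 * ∑ β
  zeros≤ total = +-cancelˡ-≤ n _ _ (begin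
    n + ∑ ζ                          ≡⟨ cong (_+ ∑ ζ) total ⟨
    ∑ φ + ∑ ζ                        ≡⟨ ∑-distrib-+ φ ζ ⟨
    ∑ (λ u → φ u + ζ u)              ≤⟨ ∑-mono-≤ excess ⟩
    ∑ (λ u → 1 + 2 * β u)            ≡⟨ ∑-distrib-+ _ _ ⟩
    ∑ {n} (λ _ → 1) + ∑ (λ u → 2 * β u)  ≡⟨ cong₂ _+_ (∑-one n) (sym (*-distribˡ-∑ 2 β)) ⟩
    n + 2 * ∑ β                      ∎)
    where open ≤-Reasoning

  -- Posimodularity: each cut gives up the closed neighbourhood `N[_]` of the other, and the total
  -- boundary capacity does not grow.
  module Uncrossing {b b′} (A B : Fin n → Bool)
    (rA : Rooted b A) (rB : Rooted b′ B) (minA : Minimal b A) (minB : Minimal b′ B) where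

    N[_] : (Fin n → Bool) → Fin n → Bool
    N[ X ] u = X u ∨ N X u

    N[]-false : ∀ X {u} → N[ X ] u ≡ false → X u ≡ false × N X u ≡ false
    N[]-false X {u} h with X u | N X u | h
    ... | false | false | _ = refl , refl

    A₁ B₁ : Fin n → Bool
    A₁ = A ∖ N[ B ]
    B₁ = B ∖ N[ A ]

    -- A vertex of `Y` has no neighbour outside `N[ Y ]`.
    avoids : ∀ X Y {x} → N (X ∖ N[ Y ]) x ≡ true → Y x ≡ false
    avoids X Y {x} h with true-or-false (Y x)
    ... | inj₂ Yx = Yx
    ... | inj₁ Yx with y , Xy , adj ← N-adj (X ∖ N[ Y ]) h
                  with Yy , NYy ← N[]-false Y (proj₂ (∖-elim X N[ Y ] Xy)) =
      ⊥-elim (true≢false (N-intro Y x Yx (symm G adj) Yy) NYy)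

    -- If `x` lies in `X`, it was removed, so it is in `N[ Y ]`; by `avoids` it is not in `Y`
    -- itself.
    covered : ∀ X Y {x} → N (X ∖ N[ Y ]) x ≡ true → N X x ≡ true ⊎ N Y x ≡ true
    covered X Y {x} h with y , Xy , adj ← N-adj (X ∖ N[ Y ]) h with true-or-false (X x)
    ... | inj₂ Xx = inj₁ (N-intro X y (proj₁ (∖-elim X N[ Y ] Xy)) adj Xx)
    ... | inj₁ Xx with true-or-false (N Y x)
    ...   | inj₁ NYx = inj₂ NYx
    ...   | inj₂ NYx = ⊥-elim (true≢false
              (∖-intro X N[ Y ] Xx (cong₂ _∨_ (avoids X Y h) NYx)) (N-outside (X ∖ N[ Y ]) h))

    both : ∀ {x} → N A₁ x ≡ true → N B₁ x ≡ true → N A x ≡ true × N B x ≡ true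
    both {x} h h′ with y , Ay , adj ← N-adj A₁ h with y′ , By′ , adj′ ← N-adj B₁ h′ =
      N-intro A y (proj₁ (∖-elim A N[ B ] Ay)) adj (avoids B A h′) ,
      N-intro B y′ (proj₁ (∖-elim B N[ A ] By′)) adj′ (avoids A B h)

    posimodular : ∀ x → cost A₁ x + cost B₁ x ≤ suc n * c x * (𝟙 (N A x) + 𝟙 (N B x)) + (𝟙 (A₁ x) + 𝟙 (B₁ x))
    posimodular x = ≤-trans (≤-reflexive (regroup (suc n * c x) (𝟙 (N A₁ x)) (𝟙 (A₁ x)) (𝟙 (N B₁ x)) (𝟙 (B₁ x))))
      (+-monoˡ-≤ _ (*-monoʳ-≤ (suc n * c x) (𝟙-pair (covered A B) swapped both)))
      where
      regroup : ∀ w a b a′ b′ → w * a + b + (w * a′ + b′) ≡ w * (a + a′) + (b + b′)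
      regroup = solve-∀
      swapped : N B₁ x ≡ true → N A x ≡ true ⊎ N B x ≡ true
      swapped h with covered B A h
      ... | inj₁ p = inj₂ p
      ... | inj₂ p = inj₁ p

    recombine : ∀ x → suc n * c x * (𝟙 (N A x) + 𝟙 (N B x)) + (𝟙 (A x) + 𝟙 (B x)) ≡ cost A x + cost B x
    recombine x = regroup (suc n * c x) (𝟙 (N A x)) (𝟙 (A x)) (𝟙 (N B x)) (𝟙 (B x))
      where
      regroup : ∀ w a b a′ b′ → w * (a + a′) + (b + b′) ≡ w * a + b + (w * a′ + b′)
      regroup = solve-∀

    -- The roots survive, so `A₁` and `B₁` compete with `A` and `B`. Their total boundary capacity
    -- is no larger, and a common vertex `s` would make `A₁` strictly smaller than `A`, against
    -- minimality.
    disjoint : A b′ ≡ false → N A b′ ≡ false → B b ≡ false → N B b ≡ false →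
               ∀ s → A s ≡ true → B s ≡ true → ⊥
    disjoint Ab′ NAb′ Bb NBb s As Bs = <⇒≱ strict (+-mono-≤ (minA A₁ rA₁) (minB B₁ rB₁))
      where
      rA₁ : Rooted b A₁
      rA₁ = ∖-intro A N[ B ] (proj₁ rA) (cong₂ _∨_ Bb NBb) ,
            λ u h → proj₂ rA u (proj₁ (∖-elim A N[ B ] h))
      rB₁ : Rooted b′ B₁
      rB₁ = ∖-intro B N[ A ] (proj₁ rB) (cong₂ _∨_ Ab′ NAb′) ,
            λ u h → proj₂ rB u (proj₁ (∖-elim B N[ A ] h))
      weak : ∀ x → cost A₁ x + cost B₁ x ≤ cost A x + cost B x
      weak x = ≤-trans (posimodular x) (≤-trans
        (+-monoʳ-≤ (suc n * c x * (𝟙 (N A x) + 𝟙 (N B x))) (+-mono-≤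
          (𝟙-mono (λ h → proj₁ (∖-elim A N[ B ] h))) (𝟙-mono (λ h → proj₁ (∖-elim B N[ A ] h)))))
        (≤-reflexive (recombine x)))
      strict-s : cost A₁ s + cost B₁ s < cost A s + cost B s
      strict-s = ≤-<-trans (posimodular s) (<-≤-trans
        (+-monoʳ-< (suc n * c s * (𝟙 (N A s) + 𝟙 (N B s))) (+-mono-<-≤
          (subst₂ (λ a a′ → 𝟙 a < 𝟙 a′) (sym (∖-gone A N[ B ] (cong (_∨ N B s) Bs))) (sym As) (s≤s z≤n))
          (𝟙-mono (λ h → proj₁ (∖-elim B N[ A ] h)))))
        (≤-reflexive (recombine s)))
      strict : g A₁ + g B₁ < g A + g B
      strict = subst₂ _<_ (∑-distrib-+ _ _) (∑-distrib-+ _ _) (∑-mono-< weak s strict-s)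

  -- A minimal cut is connected, so a cut around an outside neighbour z which
  -- does not contain its root has to cross it.
  crossing : ∀ {b z} A C → Rooted b A → Minimal b A → C z ≡ true → C b ≡ false →
             N A z ≡ true → ∃[ s ] N C s ≡ true × A s ≡ true
  crossing {b} {z} A C rA minA Cz Cb NAz
    with any? (λ s → (N C s Bool.≟ true) ×-dec (A s Bool.≟ true))
  ... | yes found = found
  ... | no none with y , Ay , adj ← N-adj A NAz =
    ⊥-elim (<⇒≱ (∑-mono-< weak y strict) (minA (A ∖ C) rooted))
    where
    separate : ∀ {s} → A s ≡ true → N C s ≡ false
    separate As = ≢true⇒false λ h → none (_ , h , As)
    -- Otherwise `y`, a neighbour of `z`, would be a vertex of `A` in `N C`. Hence removing `C`
    -- makes `A` strictly smaller.
    Cy : C y ≡ true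
    Cy with true-or-false (C y)
    ... | inj₁ h = h
    ... | inj₂ h = ⊥-elim (true≢false (N-intro C z Cz (symm G adj) h) (separate Ay))
    rooted : Rooted b (A ∖ C)
    rooted = ∖-intro A C (proj₁ rA) Cb , λ u h → proj₂ rA u (proj₁ (∖-elim A C h))
    -- No edge joins `A ∖ C` to the part of `A` inside `C`: its end outside `C` would lie in `N C`
    -- and in `A`.
    N-sub : ∀ x → N (A ∖ C) x ≡ true → N A x ≡ true
    N-sub x h with a , ACa , adj′ ← N-adj (A ∖ C) h with Aa , Ca ← ∖-elim A C ACa
      with true-or-false (A x)
    ... | inj₂ Ax = N-intro A a Aa adj′ Ax
    ... | inj₁ Ax with true-or-false (C x)
    ...   | inj₁ Cx = ⊥-elim (true≢false (N-intro C x Cx (symm G adj′) Ca) (separate Aa))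
    ...   | inj₂ Cx = ⊥-elim (true≢false (∖-intro A C Ax Cx) (N-outside (A ∖ C) h))
    weak : ∀ x → cost (A ∖ C) x ≤ cost A x
    weak x = cost-mono (A ∖ C) A x (N-sub x) λ h → proj₁ (∖-elim A C h)
    strict : cost (A ∖ C) y < cost A y
    strict = +-mono-≤-< (*-monoʳ-≤ (suc n * c y) (𝟙-mono (N-sub y)))
      (subst₂ (λ a a′ → 𝟙 a < 𝟙 a′) (sym (∖-gone A C Cy)) (sym Ay) (s≤s z≤n))

-- Connectivity and double counting.

opaque
  unfolding ∑

  ∣tabulate∣ : ∀ {n} (B : Fin n → Bool) → ∣ Vec.tabulate B ∣ ≡ ∑ λ x → 𝟙 (B x)
  ∣tabulate∣ {zero}  B = refl
  ∣tabulate∣ {suc n} B with B zero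
  ... | true  = cong suc (∣tabulate∣ (B ∘ suc))
  ... | false = ∣tabulate∣ (B ∘ suc)

module Contradiction {n} (G : Graph n) (adj? : ∀ x y → Dec (Adj G x y)) (φ : Pebbling n)
  (t : ℕ) (conn : ConnectivityAtLeast G (8 * (t * t)))
  (total : ∑ φ ≡ n) (light : ∀ u → φ u < t) (x : Fin n) (φx : φ x ≡ 0)
  where

  open Collect G adj?
  open Counting G adj? φ

  -- A walk that starts in `A` and avoids `N A` never leaves `A`, so a smaller boundary would
  -- separate `u` from `v`.
  separator : ∀ A {u v} → A u ≡ true → A v ≡ false → N A v ≡ false →
              8 * (t * t) ≤ ∑ λ w → 𝟙 (N A w)
  separator A {u} {v} Au Av NAv = ≮⇒≥ λ lt →
    let ℓ , walk = proj₂ conn S (subst (_< 8 * (t * t)) (sym (∣tabulate∣ (N A))) lt) u v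
                     (∉S (≢true⇒false λ h → true≢false Au (N-outside A h))) (∉S NAv)
    in true≢false (stays walk Au) Av
    where
    S = Vec.tabulate (N A)
    ∉S : ∀ {w} → N A w ≡ false → w ∉ S
    ∉S {w} NAw w∈S = true≢false (trans (sym (lookup∘tabulate (N A) w)) ([]=⇒lookup w∈S)) NAw
    S∌ : ∀ {w} → w ∉ S → N A w ≡ false
    S∌ {w} w∉S = ≢true⇒false λ h → w∉S (lookup⇒[]= w S (trans (lookup∘tabulate (N A) w) h))
    start : ∀ {w w′ ℓ} → WalkIn G (_∉ S) w w′ ℓ → w ∉ S
    start (here h)     = h
    start (step h _ _) = h
    stays : ∀ {w w′ ℓ} → WalkIn G (_∉ S) w w′ ℓ → A w ≡ true → A w′ ≡ true
    stays (here _) Aw = Aw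
    stays (step {u = w} {w = w₁} _ adj walk) Aw with true-or-false (A w₁)
    ... | inj₁ Aw₁ = stays walk Aw₁
    ... | inj₂ Aw₁ = ⊥-elim (true≢false (N-intro A w Aw adj Aw₁) (S∌ (start walk)))

  t≥1 : 1 ≤ t
  t≥1 = ≤-trans (s≤s z≤n) (light x)

  t≤tt : t ≤ t * t
  t≤tt = ≤-trans (≤-reflexive (sym (*-identityˡ t))) (*-monoˡ-≤ t t≥1)

  tt≥1 : 1 ≤ t * t
  tt≥1 = ≤-trans t≥1 t≤tt

  ζx : ζ x ≡ 1
  ζx = cong 𝟙 (dec-true (φ x ≟ 0) φx)

  zeros≥1 : 1 ≤ ∑ ζ
  zeros≥1 = ≤-trans (≤-reflexive (sym ζx)) (term≤∑ ζ x)

  ∃big : ∃[ b ] big b ≡ true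
  ∃big with any? (λ b → big b Bool.≟ true)
  ... | yes found = found
  ... | no none = contradiction (≤-trans zeros≥1 (≤-trans (zeros≤ total) (≤-reflexive (cong (2 *_)
        (∑-zero β λ u → trans (cong (λ b → c u * 𝟙 b) (≢true⇒false λ h → none (u , h))) (*-zeroʳ (c u))))))) λ ()

  big≢zero : ∀ {b z} → big b ≡ true → φ z ≡ 0 → ¬ b ≡ z
  big≢zero bigb φz refl = contradiction (subst (2 ≤_) φz (big-≥2 bigb)) λ ()

  cover : ∀ u → 1 ≤ ζ u + c u
  cover u with φ u
  ... | 0 = s≤s z≤n
  ... | 1 = s≤s z≤n
  ... | suc (suc _) = s≤s z≤n

  -- A nonempty vertex has capacity at least 1, so the capacity of `N A` pays for its nonempty
  -- vertices.
  ∣N∣≤ : ∀ A → ∑ (λ w → 𝟙 (N A w)) ≤ wt ζ (N A) + wt c (N A)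
  ∣N∣≤ A = begin
    ∑ (λ w → 𝟙 (N A w))                                   ≤⟨ ∑-mono-≤ (λ w → ≤-trans
        (≤-reflexive (sym (*-identityˡ _))) (*-monoˡ-≤ (𝟙 (N A w)) (cover w))) ⟩
    ∑ (λ w → (ζ w + c w) * 𝟙 (N A w))                     ≡⟨ ∑-cong (λ w → *-distribʳ-+ (𝟙 (N A w)) (ζ w) (c w)) ⟩
    ∑ (λ w → ζ w * 𝟙 (N A w) + c w * 𝟙 (N A w))           ≡⟨ ∑-distrib-+ _ _ ⟩
    wt ζ (N A) + wt c (N A)                               ∎
    where open ≤-Reasoning

  1≤c-big : ∀ {u} → big u ≡ true → 1 ≤ c u
  1≤c-big {u} h with φ u | big-≥2 h
  ... | suc (suc _) | _ = s≤s z≤n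
  ... | 1 | s≤s ()

  wt≤∑ : ∀ A → wt ζ (N A) ≤ ∑ ζ
  wt≤∑ A = ∑-mono-≤ λ w → ≤-trans (*-monoʳ-≤ (ζ w) (𝟙≤1 (N A w))) (≤-reflexive (*-identityʳ _))

  -- The boundary of a cut for one pebble has capacity 0, so it consists of empty vertices. A vertex
  -- `b` with at least two pebbles lies beyond it, which makes `separator` applicable.
  many-zeros : ∃ (Cut φ x 1) → 8 * (t * t) ≤ ∑ ζ
  many-zeros (A , cut) with b , bigb ← ∃big = begin
    8 * (t * t)                 ≤⟨ separator A root Ab NAb ⟩
    ∑ (λ w → 𝟙 (N A w))         ≤⟨ ∣N∣≤ A ⟩
    wt ζ (N A) + wt c (N A)     ≡⟨ cong (wt ζ (N A) +_) (n≤0⇒n≡0 (≤-pred small)) ⟩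
    wt ζ (N A) + 0              ≡⟨ +-identityʳ _ ⟩
    wt ζ (N A)                  ≤⟨ wt≤∑ A ⟩
    ∑ ζ                         ∎
    where
    open ≤-Reasoning
    open Cut cut
    Ab : A b ≡ false
    Ab = ≢true⇒false λ h → big⇒≢1 bigb (ones h (big≢zero bigb φx))
    NAb : N A b ≡ false
    NAb = ≢true⇒false λ h → contradiction (≤-trans small
      (≤-trans (1≤c-big bigb) (≤-trans (≤-reflexive (sym (trans (cong (λ a → c b * 𝟙 a) h) (*-identityʳ (c b)))))
        (term≤∑ (λ w → c w * 𝟙 (N A w)) b)))) (<-irrefl refl)

  module _ (enough-zeros : 8 * (t * t) ≤ ∑ ζ)
           (A : Fin n → Fin n → Bool) (cut : ∀ v → MinimalCut v t (A v)) where

    open module MC v = MinimalCut (cut v)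

    foreign : ∀ {b v} → big b ≡ true → ¬ b ≡ v → A v b ≡ false
    foreign {b} {v} bigb b≢v = ≢true⇒false λ h → big⇒≢1 bigb (proj₂ (rooted v) b h b≢v)

    intersecting : ∀ {b b′ s} → big b ≡ true → big b′ ≡ true → ¬ b ≡ b′ →
      A b s ≡ true → A b′ s ≡ true → N (A b′) b ≡ true ⊎ N (A b) b′ ≡ true
    intersecting {b} {b′} {s} bigb bigb′ b≢b′ Abs Ab′s
      with true-or-false (N (A b′) b) | true-or-false (N (A b) b′)
    ... | inj₁ h | _ = inj₁ h
    ... | inj₂ _ | inj₁ h = inj₂ h
    ... | inj₂ h | inj₂ h′ = ⊥-elim (disjoint (foreign bigb′ (b≢b′ ∘ sym)) h′ (foreign bigb b≢b′) h s Abs Ab′s)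
      where open Uncrossing (A b) (A b′) (rooted b) (rooted b′) (minimal b) (minimal b′)

    cap-light : ∀ u → c u ≤ t
    cap-light u with φ u | light u
    ... | 0 | _ = z≤n
    ... | 1 | lt = <⇒≤ lt
    ... | suc (suc p) | lt = ≤-trans (s≤s (≤-trans (⌊n/2⌋≤n p) (n≤1+n p))) (<⇒≤ lt)

    -- Squaring the sum: by `intersecting`, two distinct b, b′ with s in both cuts
    -- are charged to the capacity of N (A b) or of N (A b′).
    load-at : ∀ s → wt β (λ b → A b s) ≤ 3 * t
    load-at s with wt β (λ b → A b s) in eq
    ... | zero  = z≤n
    ... | suc m = *-cancelˡ-≤ (suc m) (begin
      suc m * suc m                       ≡⟨ cong₂ _*_ eq eq ⟨
      ∑ X * ∑ X                           ≡⟨ *-distribʳ-∑ (∑ X) X ⟩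
      ∑ (λ b → X b * ∑ X)                 ≡⟨ ∑-cong (λ b → *-distribˡ-∑ (X b) X) ⟩
      ∑ (λ b → ∑ λ b′ → X b * X b′)       ≤⟨ ∑-mono-≤ (λ b → ∑-mono-≤ λ b′ → charge b b′) ⟩
      ∑ (λ b → ∑ λ b′ → own b b′ + (out₁ b b′ + out₁ b′ b))
                                          ≡⟨ ∑-cong (λ b → trans (∑-distrib-+ (own b) _)
                                               (cong (∑ (own b) +_) (∑-distrib-+ (out₁ b) _))) ⟩
      ∑ (λ b → ∑ (own b) + (∑ (out₁ b) + ∑ λ b′ → out₁ b′ b))
                                          ≡⟨ trans (∑-distrib-+ _ _) (cong (∑ (λ b → ∑ (own b)) +_) (∑-distrib-+ _ _)) ⟩
      ∑ (λ b → ∑ (own b)) + (∑ (λ b → ∑ (out₁ b)) + ∑ (λ b → ∑ λ b′ → out₁ b′ b))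
                                          ≡⟨ cong (λ y → ∑ (λ b → ∑ (own b)) + (∑ (λ b → ∑ (out₁ b)) + y)) (∑-comm (λ b b′ → out₁ b′ b)) ⟩
      ∑ (λ b → ∑ (own b)) + (∑ (λ b → ∑ (out₁ b)) + ∑ (λ b → ∑ (out₁ b)))
                                          -- `own` is bounded because one vertex has capacity at
                                          -- most `t`, each copy of `out₁` because the boundary of
                                          -- `A b` has capacity less than `t`; together they give
                                          -- the factor 3.
                                          ≤⟨ +-mono-≤ (∑-mono-≤ own-bound) (+-mono-≤ (∑-mono-≤ out-bound) (∑-mono-≤ out-bound)) ⟩
      ∑ (λ b → X b * t) + (∑ (λ b → X b * t) + ∑ (λ b → X b * t))
                                          ≡⟨ cong (λ y → y + (y + y)) (trans (sym (*-distribʳ-∑ t X)) (cong (_* t) eq)) ⟩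
      suc m * t + (suc m * t + suc m * t) ≡⟨ triple (suc m) t ⟩
      suc m * (3 * t)                     ∎)
      where
      open ≤-Reasoning
      X : Fin n → ℕ
      X b = β b * 𝟙 (A b s)
      own out₁ : Fin n → Fin n → ℕ
      own  b b′ = X b * (β b′ * 𝟙 (b′ == b))
      out₁ b b′ = X b * (β b′ * 𝟙 (N (A b) b′))
      triple : ∀ m t → m * t + (m * t + m * t) ≡ m * (3 * t)
      triple = solve-∀
      own-bound : ∀ b → ∑ (own b) ≤ X b * t
      own-bound b = ≤-trans (≤-reflexive (trans (sym (*-distribˡ-∑ (X b) _)) (cong (X b *_) (∑-δ β b))))
        (*-monoʳ-≤ (X b) (≤-trans (β≤c b) (cap-light b)))
      out-bound : ∀ b → ∑ (out₁ b) ≤ X b * t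
      out-bound b = ≤-trans (≤-reflexive (sym (*-distribˡ-∑ (X b) _)))
        (*-monoʳ-≤ (X b) (≤-trans (∑-mono-≤ λ b′ → *-monoˡ-≤ (𝟙 (N (A b) b′)) (β≤c b′)) (<⇒≤ (small b))))
      X-zero : ∀ b → big b ≡ false ⊎ A b s ≡ false → X b ≡ 0
      X-zero b (inj₁ h) = cong (_* 𝟙 (A b s)) (trans (cong (λ a → c b * 𝟙 a) h) (*-zeroʳ (c b)))
      X-zero b (inj₂ h) = trans (cong (λ a → β b * 𝟙 a) h) (*-zeroʳ (β b))
      member : ∀ b → X b ≡ 0 ⊎ (big b ≡ true × A b s ≡ true)
      member b with true-or-false (big b) | true-or-false (A b s)
      ... | inj₁ h | inj₁ h′ = inj₂ (h , h′)
      ... | inj₂ h | _       = inj₁ (X-zero b (inj₁ h))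
      ... | inj₁ _ | inj₂ h′ = inj₁ (X-zero b (inj₂ h′))
      X≤β : ∀ b → X b ≤ β b
      X≤β b = ≤-trans (*-monoʳ-≤ (β b) (𝟙≤1 (A b s))) (≤-reflexive (*-identityʳ _))
      X*X≤ : ∀ b b′ {a} → a ≡ true → X b * X b′ ≤ X b * (β b′ * 𝟙 a)
      X*X≤ b b′ refl = *-monoʳ-≤ (X b) (≤-trans (X≤β b′) (≤-reflexive (sym (*-identityʳ _))))
      charge : ∀ b b′ → X b * X b′ ≤ own b b′ + (out₁ b b′ + out₁ b′ b)
      charge b b′ with member b | member b′
      ... | inj₁ z | _      = ≤-trans (≤-reflexive (cong (_* X b′) z)) z≤n
      ... | inj₂ _ | inj₁ z = ≤-trans (≤-reflexive (trans (cong (X b *_) z) (*-zeroʳ (X b)))) z≤n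
      ... | inj₂ (bigb , Abs) | inj₂ (bigb′ , Ab′s) with ≡-or-≢ b b′
      ...   | inj₁ refl = ≤-trans (X*X≤ b b′ (==-refl b)) (m≤m+n _ _)
      ...   | inj₂ b≢b′ with intersecting bigb bigb′ b≢b′ Abs Ab′s
      ...     | inj₂ h = ≤-trans (X*X≤ b b′ h) (≤-trans (m≤m+n _ _) (m≤n+m _ (own b b′)))
      ...     | inj₁ h = ≤-trans (≤-reflexive (*-comm (X b) (X b′)))
                  (≤-trans (X*X≤ b′ b h) (≤-trans (m≤n+m _ (out₁ b b′)) (m≤n+m _ (own b b′))))

    7tt+t≤ : 7 * (t * t) + t ≤ 8 * (t * t)
    7tt+t≤ = ≤-trans (+-monoʳ-≤ (7 * (t * t)) t≤tt) (≤-reflexive (eight (t * t)))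
      where
      eight : ∀ a → 7 * a + a ≡ 8 * a
      eight = solve-∀

    -- An empty vertex missed by `N (A b)` also lies outside `A b`, so `separator` yields
    -- `8 * (t * t)` boundary vertices, fewer than `t` of them nonempty. If none is missed, all
    -- empty vertices count.
    many-zero-neighbours : ∀ {b} → big b ≡ true → 7 * (t * t) ≤ wt ζ (N (A b))
    many-zero-neighbours {b} bigb
      with any? (λ z → (zer z Bool.≟ true) ×-dec (N (A b) z Bool.≟ false))
    ... | yes (z , zerz , NAz) = +-cancelʳ-≤ t _ _ (begin
          7 * (t * t) + t                     ≤⟨ 7tt+t≤ ⟩
          8 * (t * t)                         ≤⟨ separator (A b) (proj₁ (rooted b)) Az NAz ⟩
          ∑ (λ w → 𝟙 (N (A b) w))             ≤⟨ ∣N∣≤ (A b) ⟩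
          wt ζ (N (A b)) + wt c (N (A b))     ≤⟨ +-monoʳ-≤ _ (<⇒≤ (small b)) ⟩
          wt ζ (N (A b)) + t                  ∎)
      where
      open ≤-Reasoning
      φz : φ z ≡ 0
      φz = does-true (φ z ≟ 0) zerz
      Az : A b z ≡ false
      Az = ≢true⇒false λ h → contradiction (trans (sym φz) (proj₂ (rooted b) z h
        (big≢zero bigb φz ∘ sym))) λ ()
    ... | no none = begin
          7 * (t * t)        ≤⟨ m≤m+n _ t ⟩
          7 * (t * t) + t    ≤⟨ 7tt+t≤ ⟩
          8 * (t * t)        ≤⟨ enough-zeros ⟩
          ∑ ζ                ≤⟨ ∑-mono-≤ all-in ⟩
          wt ζ (N (A b))     ∎
      where
      open ≤-Reasoning
      all-in : ∀ z → ζ z ≤ ζ z * 𝟙 (N (A b) z)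
      all-in z with true-or-false (N (A b) z) | true-or-false (zer z)
      ... | inj₁ h | _ = ≤-reflexive (sym (trans (cong (λ a → ζ z * 𝟙 a) h) (*-identityʳ _)))
      ... | inj₂ h | inj₁ zerz = contradiction (z , zerz , h) none
      ... | inj₂ h | inj₂ ¬zerz = ≤-trans (≤-reflexive (cong 𝟙 ¬zerz)) z≤n

    -- Averaging: the pairs of `b` and an empty `z` in `N (A b)` have total `β`-weight at least
    -- `∑ β * D`, while there are at most `2 * ∑ β` empty vertices, hence the factor 2.
    popular-zero : ∃[ z ] zer z ≡ true × 7 * (t * t) ≤ 2 * wt β (λ b → N (A b) z)
    popular-zero with any? (λ z → (zer z Bool.≟ true) ×-dec (7 * (t * t) ≤? 2 * wt β (λ b → N (A b) z)))
    ... | yes found = found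
    ... | no none = ⊥-elim (<-irrefl refl (begin-strict
        2 * (∑ β * D)                            ≡⟨ cong (2 *_) (*-distribʳ-∑ D β) ⟩
        2 * ∑ (λ b → β b * D)                    ≤⟨ *-monoʳ-≤ 2 (∑-mono-≤ per-b) ⟩
        2 * ∑ (λ b → β b * wt ζ (N (A b)))       ≡⟨ cong (2 *_) exchanged ⟩
        2 * ∑ (λ z → ζ z * W z)                  ≡⟨ *-distribˡ-∑ 2 _ ⟩
        -- Strictness comes from the term at `x`, which is itself empty.
        ∑ (λ z → 2 * (ζ z * W z))                <⟨ ∑-mono-< per-z x at-x ⟩
        ∑ (λ z → ζ z * D)                        ≡⟨ *-distribʳ-∑ D ζ ⟨
        ∑ ζ * D                                  ≤⟨ *-monoˡ-≤ D (zeros≤ total) ⟩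
        2 * ∑ β * D                              ≡⟨ *-assoc 2 (∑ β) D ⟩
        2 * (∑ β * D)                            ∎))
      where
      open ≤-Reasoning
      D : ℕ
      D = 7 * (t * t)
      W : Fin n → ℕ
      W z = wt β (λ b → N (A b) z)
      per-b : ∀ b → β b * D ≤ β b * wt ζ (N (A b))
      per-b b with true-or-false (big b)
      ... | inj₁ bigb = *-monoʳ-≤ (β b) (many-zero-neighbours bigb)
      ... | inj₂ h = ≤-trans (≤-reflexive (cong (_* D) (trans (cong (λ a → c b * 𝟙 a) h) (*-zeroʳ (c b))))) z≤n
      exchange : ∀ a b i → a * (b * i) ≡ b * (a * i)
      exchange = solve-∀
      exchanged : ∑ (λ b → β b * wt ζ (N (A b))) ≡ ∑ (λ z → ζ z * W z)
      exchanged = trans (∑-cong λ b → trans (*-distribˡ-∑ (β b) _) (∑-cong λ z → exchange (β b) (ζ z) _))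
        (trans (∑-comm λ b z → ζ z * (β b * 𝟙 (N (A b) z))) (∑-cong λ z → sym (*-distribˡ-∑ (ζ z) _)))
      few : ∀ z → zer z ≡ true → 2 * W z < D
      few z zerz = ≰⇒> λ h → none (z , zerz , h)
      per-z : ∀ z → 2 * (ζ z * W z) ≤ ζ z * D
      per-z z with true-or-false (zer z)
      ... | inj₂ h = ≤-trans (≤-reflexive (cong (λ a → 2 * (𝟙 a * W z)) h)) z≤n
      ... | inj₁ h = ≤-trans (≤-reflexive (exchange 2 (ζ z) (W z))) (*-monoʳ-≤ (ζ z) (<⇒≤ (few z h)))
      at-x : 2 * (ζ x * W x) < ζ x * D
      at-x = subst₂ _<_ (cong (2 *_) (trans (sym (*-identityˡ _)) (cong (_* W x) (sym ζx))))
        (trans (sym (*-identityˡ _)) (cong (_* D) (sym ζx))) (few x (𝟙-true (≤-reflexive (sym ζx))))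

    -- Every `b` counted at `z` has a cut meeting `N (A z)`. That boundary has capacity less than
    -- `t` and load at most `3 * t` at each vertex, too little for the weight that `popular-zero`
    -- provides.
    absurd : ⊥
    absurd with z , zerz , popular ← popular-zero = <-irrefl refl (begin-strict
        6 * (t * t)                                            <⟨ +-monoˡ-≤ (6 * (t * t)) tt≥1 ⟩
        7 * (t * t)                                            ≤⟨ popular ⟩
        2 * wt β (λ b → N (A b) z)                             ≤⟨ *-monoʳ-≤ 2 (∑-mono-≤ (crossed z zerz)) ⟩
        2 * ∑ (λ b → ∑ λ s → (c s * 𝟙 (N (A z) s)) * (β b * 𝟙 (A b s)))
          ≡⟨ cong (2 *_) (trans (∑-comm _) (∑-cong λ s → sym (*-distribˡ-∑ (c s * 𝟙 (N (A z) s)) _))) ⟩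
        2 * ∑ (λ s → (c s * 𝟙 (N (A z) s)) * wt β (λ b → A b s))
          ≤⟨ *-monoʳ-≤ 2 (∑-mono-≤ λ s → *-monoʳ-≤ (c s * 𝟙 (N (A z) s)) (load-at s)) ⟩
        2 * ∑ (λ s → (c s * 𝟙 (N (A z) s)) * (3 * t))          ≡⟨ cong (2 *_) (*-distribʳ-∑ (3 * t) _) ⟨
        2 * (wt c (N (A z)) * (3 * t))                         ≤⟨ *-monoʳ-≤ 2 (*-monoˡ-≤ (3 * t) (<⇒≤ (small z))) ⟩
        2 * (t * (3 * t))                                      ≡⟨ six t ⟩
        6 * (t * t)                                            ∎)
      where
      open ≤-Reasoning
      six : ∀ t → 2 * (t * (3 * t)) ≡ 6 * (t * t)
      six = solve-∀
      crossed : ∀ z → zer z ≡ true → ∀ b →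
        β b * 𝟙 (N (A b) z) ≤ ∑ λ s → (c s * 𝟙 (N (A z) s)) * (β b * 𝟙 (A b s))
      crossed z zerz b with true-or-false (big b) | true-or-false (N (A b) z)
      ... | inj₂ h | _ = ≤-trans (≤-reflexive (cong (_* 𝟙 (N (A b) z)) (trans (cong (λ a → c b * 𝟙 a) h) (*-zeroʳ (c b))))) z≤n
      ... | inj₁ _ | inj₂ h = ≤-trans (≤-reflexive (trans (cong (λ a → β b * 𝟙 a) h) (*-zeroʳ (β b)))) z≤n
      ... | inj₁ bigb | inj₁ NAbz
        with s , NAzs , Abs ← crossing (A b) (A z) (rooted b) (minimal b) (proj₁ (rooted z))
          (foreign bigb (big≢zero bigb (does-true (φ z ≟ 0) zerz))) NAbz
        = begin
          β b * 𝟙 (N (A b) z)       ≤⟨ *-monoʳ-≤ (β b) (≤-trans (𝟙≤1 (N (A b) z)) (𝟙-pos Abs)) ⟩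
          β b * 𝟙 (A b s)           ≡⟨ *-identityˡ _ ⟨
          1 * (β b * 𝟙 (A b s))     ≤⟨ *-monoˡ-≤ (β b * 𝟙 (A b s)) (*-mono-≤ (1≤c s Abs) (𝟙-pos NAzs)) ⟩
          (c s * 𝟙 (N (A z) s)) * (β b * 𝟙 (A b s))  ≤⟨ term≤∑ (λ s → (c s * 𝟙 (N (A z) s)) * (β b * 𝟙 (A b s))) s ⟩
          _                         ∎
        where
        -- A vertex of `A b` is the root, with at least two pebbles, or carries one; so the capacity
        -- of `N (A z)` counts it.
        1≤c : ∀ s → A b s ≡ true → 1 ≤ c s
        1≤c s Abs with ≡-or-≢ s b
        ... | inj₁ refl = 1≤c-big bigb
        ... | inj₂ s≢b = ≤-reflexive (sym (cong cap (proj₂ (rooted b) s Abs s≢b)))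

-- The upper bound for decidable adjacency.

all-or : ∀ {n} {P : Fin n → Set} {Q : Set} → (∀ i → P i ⊎ Q) → (∀ i → P i) ⊎ Q
all-or {zero}  h = inj₁ λ ()
all-or {suc n} h with h zero | all-or (h ∘ suc)
... | inj₂ q | _      = inj₂ q
... | inj₁ _ | inj₂ q = inj₂ q
... | inj₁ p | inj₁ ps = inj₁ λ { zero → p ; (suc i) → ps i }

opaque
  unfolding ∑

  sum-tabulate : ∀ {n} (φ : Fin n → ℕ) → ListAction.sum (List.tabulate φ) ≡ ∑ φ
  sum-tabulate {zero}  φ = refl
  sum-tabulate {suc n} φ = cong (φ zero +_) (sum-tabulate (φ ∘ suc))

size≡∑ : ∀ {n} (φ : Pebbling n) → size φ ≡ ∑ φ
size≡∑ φ = trans (cong ListAction.sum (map-tabulate id φ)) (sum-tabulate φ)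

collected⇒pebbled : ∀ {n} (G : Graph n) (adj? : ∀ x y → Dec (Adj G x y)) {d} → DiameterAtMost G d →
  ∀ {φ} v x → Collect.Collects G adj? φ v (2 ^ d) → CanPebble G φ x
collected⇒pebbled G adj? diam v x (ψ , desc , enough)
  with ℓ , ℓ≤d , walk ← diam v x
  with χ , desc′ , 1≤χ ← Moves.along-walk G walk ψ
         (≤-trans (^-monoʳ-≤ 2 ℓ≤d) (≤-trans (m≤n+m _ _) enough))
  = χ , desc ◅◅ desc′ , 1≤χ

solvable-decidable : ∀ {n} (G : Graph n) → (∀ x y → Dec (Adj G x y)) → ∀ d →
  DiameterAtMost G d → ConnectivityAtLeast G (8 * (2 ^ d * 2 ^ d)) → Solvable G n
solvable-decidable {n} G adj? d diam conn φ size≡n x with φ x in φx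
... | suc _ = φ , ε , subst (1 ≤_) (sym φx) (s≤s z≤n)
... | zero with any? (λ u → 2 ^ d ≤? φ u)
...   | yes (u , heavy) = let ℓ , ℓ≤d , walk = diam u x in
        Moves.along-walk G walk φ (≤-trans (^-monoʳ-≤ 2 ℓ≤d) heavy)
-- Either `x` gains a pebble, or some `v` collects `2 ^ d` pebbles and so reaches `x`, or all the
-- cuts exist that lead to a contradiction.
...   | no none with Collect.menger G adj? φ x 1
                   | all-or (λ v → swap (map₁ (collected⇒pebbled G adj? diam v x) (Collect.menger G adj? φ v (2 ^ d))))
...     | inj₁ (ψ , desc , ≥1) | _ = ψ , desc , ≤-trans (m≤n+m 1 (φ x)) ≥1
...     | inj₂ _ | inj₂ solved = solved
...     | inj₂ cutx | inj₁ cuts = ⊥-elim (absurd (many-zeros cutx) (λ v → proj₁ (min v)) λ v → proj₂ (min v))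
  where
  open Contradiction G adj? φ (2 ^ d) conn (trans (sym (size≡∑ φ)) size≡n)
    (λ u → ≰⇒> λ h → none (u , h)) x φx
  open Counting G adj? φ
  min : ∀ v → ∃ (MinimalCut v (2 ^ d))
  min v = minimalCut (cuts v)

-- Reduction to decidable adjacency.

-- Adjacency need not be decidable, but the hypotheses only produce finitely many
-- walks, and the edges on these walks form a decidable subgraph satisfying them too.
module Subgraph {n} (G : Graph n) where

  Edge : Set
  Edge = Σ (Fin n × Fin n) λ (x , y) → Adj G x y

  Joins : Fin n → Fin n → Edge → Set
  Joins x y (e , _) = e ≡ (x , y) ⊎ e ≡ (y , x)

  joins⇒adj : ∀ {x y} e → Joins x y e → Adj G x y
  joins⇒adj (_ , adj) (inj₁ refl) = adj
  joins⇒adj (_ , adj) (inj₂ refl) = symm G adj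

  ⟨_⟩-adj⇒adj : ∀ (L : List Edge) {x y} → Any (Joins x y) L → Adj G x y
  ⟨ e ∷ _ ⟩-adj⇒adj (here j)  = joins⇒adj e j
  ⟨ _ ∷ L ⟩-adj⇒adj (there h) = ⟨ L ⟩-adj⇒adj h

  ⟨_⟩ : List Edge → Graph n
  ⟨ L ⟩ = record
    { Adj    = λ x y → Any (Joins x y) L
    ; symm   = Any.map swap
    ; irrefl = λ h → irrefl G (⟨ L ⟩-adj⇒adj h)
    }

  adj? : ∀ L x y → Dec (Adj ⟨ L ⟩ x y)
  adj? L x y = Any.any? (λ (e , _) → ≡-dec Fin._≟_ Fin._≟_ e (x , y) ⊎-dec ≡-dec Fin._≟_ Fin._≟_ e (y , x)) L

  _⊑_ : List Edge → List Edge → Set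
  L ⊑ M = ∀ {x y} → Adj ⟨ L ⟩ x y → Adj ⟨ M ⟩ x y

  Monotone : (List Edge → Set) → Set
  Monotone Q = ∀ {L M} → L ⊑ M → Q L → Q M

  walk-⊑ : ∀ {L M P u v ℓ} → L ⊑ M → WalkIn ⟨ L ⟩ P u v ℓ → WalkIn ⟨ M ⟩ P u v ℓ
  walk-⊑ L⊑M (here p)          = here p
  walk-⊑ L⊑M (step p adj walk) = step p (L⊑M adj) (walk-⊑ L⊑M walk)

  edges-of : ∀ {P u v ℓ} → WalkIn G P u v ℓ → ∃[ L ] WalkIn ⟨ L ⟩ P u v ℓ
  edges-of (here p) = [] , here p
  edges-of (step {u} {w} p adj walk) with L , walk′ ← edges-of walk =
    ((u , w) , adj) ∷ L , step p (here (inj₁ refl)) (walk-⊑ there walk′)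

  -- Finite choice: the witness lists are concatenated, and monotonicity carries each property over
  -- to the longer list.
  choose-Fin : ∀ {m} {Q : Fin m → List Edge → Set} → (∀ i → Monotone (Q i)) →
               (∀ i → ∃ (Q i)) → ∃[ L ] ∀ i → Q i L
  choose-Fin {zero}  mono h = [] , λ ()
  choose-Fin {suc m} mono h with L , q ← h zero | M , qs ← choose-Fin (λ i → mono (suc i)) (λ i → h (suc i)) =
    L ++ M , λ { zero → mono zero ++⁺ˡ q ; (suc i) → mono (suc i) (++⁺ʳ L) (qs i) }

  choose-Subset : ∀ {m} {Q : Subset m → List Edge → Set} → (∀ S → Monotone (Q S)) →
                  (∀ S → ∃ (Q S)) → ∃[ L ] ∀ S → Q S L
  choose-Subset {zero} mono h with L , q ← h Vec.[] = L , λ { Vec.[] → q }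
  choose-Subset {suc m} mono h
    with L , q  ← choose-Subset (λ S → mono (inside Vec.∷ S)) (λ S → h (inside Vec.∷ S))
       | M , q′ ← choose-Subset (λ S → mono (outside Vec.∷ S)) (λ S → h (outside Vec.∷ S))
    = L ++ M , λ { (inside Vec.∷ S)  → mono (inside Vec.∷ S) ++⁺ˡ (q S)
                 ; (outside Vec.∷ S) → mono (outside Vec.∷ S) (++⁺ʳ L) (q′ S) }

  diameter-edges : ∀ {d} → DiameterAtMost G d → ∃[ L ] DiameterAtMost ⟨ L ⟩ d
  diameter-edges diam =
    choose-Fin (λ u L⊑M h v → weaken L⊑M (h v)) λ u →
    choose-Fin (λ v → weaken) λ v → let ℓ , ℓ≤d , walk = diam u v ; L , walk′ = edges-of walk in
    L , ℓ , ℓ≤d , walk′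
    where
    weaken : ∀ {d u v L M} → L ⊑ M → ∃[ ℓ ] (ℓ ≤ d × WalkIn ⟨ L ⟩ (λ _ → ⊤) u v ℓ) →
             ∃[ ℓ ] (ℓ ≤ d × WalkIn ⟨ M ⟩ (λ _ → ⊤) u v ℓ)
    weaken L⊑M (ℓ , ℓ≤d , walk) = ℓ , ℓ≤d , walk-⊑ L⊑M walk

  Avoids : ℕ → Subset n → Fin n → Fin n → List Edge → Set
  Avoids k S u v L = ∣ S ∣ < k → u ∉ S → v ∉ S → ∃[ ℓ ] WalkIn ⟨ L ⟩ (λ x → x ∉ S) u v ℓ

  connectivity-edges : ∀ {k} → ConnectivityAtLeast G k → ∃[ L ] ConnectivityAtLeast ⟨ L ⟩ k
  connectivity-edges {k} (k<n , conn) = let L , h = chosen in L , k<n , λ S lt u v → h S u v lt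
    where
    mono : ∀ S u v → Monotone (Avoids k S u v)
    mono S u v L⊑M h lt u∉S v∉S = let ℓ , walk = h lt u∉S v∉S in ℓ , walk-⊑ L⊑M walk
    avoiding : ∀ S u v → ∃ (Avoids k S u v)
    avoiding S u v with (∣ S ∣ <? k) ×-dec (¬? (u ∈? S) ×-dec ¬? (v ∈? S))
    -- If a hypothesis fails, the claim is vacuous and the empty list serves as default.
    ... | no ¬h = [] , λ lt u∉S v∉S → contradiction (lt , u∉S , v∉S) ¬h
    ... | yes (lt , u∉S , v∉S) = let ℓ , walk = conn S lt u v u∉S v∉S ; L , walk′ = edges-of walk in
          L , λ _ _ _ → ℓ , walk′
    chosen : ∃[ L ] ∀ S u v → Avoids k S u v L
    chosen = choose-Subset (λ S L⊑M h u v → mono S u v L⊑M (h u v)) λ S →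
             choose-Fin (λ u L⊑M h v → mono S u v L⊑M (h v)) λ u →
             choose-Fin (mono S u) (avoiding S u)

  decidable-subgraph : ∀ {d k} → DiameterAtMost G d → ConnectivityAtLeast G k →
    ∃[ L ] DiameterAtMost ⟨ L ⟩ d × ConnectivityAtLeast ⟨ L ⟩ k
  decidable-subgraph diam conn with L , diam′ ← diameter-edges diam | M , k<n , conn′ ← connectivity-edges conn =
    L ++ M ,
    (λ u v → let ℓ , ℓ≤d , walk = diam′ u v in ℓ , ℓ≤d , walk-⊑ ++⁺ˡ walk) ,
    k<n , λ S lt u v u∉S v∉S → let ℓ , walk = conn′ S lt u v u∉S v∉S in ℓ , walk-⊑ (++⁺ʳ L) walk

  canPebble-⟨_⟩ : ∀ L {φ x} → CanPebble ⟨ L ⟩ φ x → CanPebble G φ x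
  canPebble-⟨ L ⟩ (ψ , desc , 1≤ψ) = ψ , gmap id lift desc , 1≤ψ
    where
    lift : ∀ {φ ψ} → Move ⟨ L ⟩ φ ψ → Move G φ ψ
    lift (move x y adj 2≤φ eq) = move x y (⟨ L ⟩-adj⇒adj adj) 2≤φ eq

solvable : ∀ {n} (G : Graph n) d → DiameterAtMost G d →
           ConnectivityAtLeast G (8 * (2 ^ d * 2 ^ d)) → Solvable G n
solvable G d diam conn φ size≡n x with L , diam′ , conn′ ← Subgraph.decidable-subgraph G diam conn =
  Subgraph.canPebble-⟨_⟩ G L
    (solvable-decidable (Subgraph.⟨_⟩ G L) (Subgraph.adj? G L) d diam′ conn′ φ size≡n x)

-- The lower bound and the conclusion.

initial : ∀ {m} → ℕ → Pebbling m
initial q i = 𝟙 (toℕ i <ᵇ q)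

opaque
  unfolding ∑

  ∑-initial : ∀ {m q} → q ≤ m → ∑ (initial {m} q) ≡ q
  ∑-initial {m} z≤n = ∑-zero {m} _ λ _ → refl
  ∑-initial (s≤s q≤m) = cong suc (∑-initial q≤m)

  ∑-suc : ∀ {m} (f : Fin (suc m) → ℕ) → ∑ f ≡ f zero + ∑ (f ∘ suc)
  ∑-suc f = refl

-- If vertex `zero` is empty and every other vertex has at most one pebble, no move is possible and
-- `zero` is never pebbled. Such a pebbling exists for every size up to `m`.
solvable⇒≥ : ∀ {m} (G : Graph (suc m)) q → Solvable G q → suc m ≤ q
solvable⇒≥ {m} G q solv = ≮⇒≥ λ { (s≤s q≤m) → unsolved q≤m }
  where
  φ : Pebbling (suc m)
  φ zero    = 0
  φ (suc i) = initial q i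
  φ≤1 : ∀ u → φ u ≤ 1
  φ≤1 zero    = z≤n
  φ≤1 (suc i) = 𝟙≤1 _
  unsolved : ¬ q ≤ m
  unsolved q≤m with solv φ (trans (size≡∑ φ) (trans (∑-suc φ) (∑-initial q≤m))) zero
  -- The empty sequence of moves would need `1 ≤ 0`, so only a first move remains to be refuted.
  ... | _ , move x _ _ 2≤φ _ ◅ _ , _ = contradiction (≤-trans 2≤φ (φ≤1 x)) λ { (s≤s ()) }

2^[2d+3]≡8*[2^d*2^d] : ∀ d → 2 ^ (2 * d + 3) ≡ 8 * (2 ^ d * 2 ^ d)
2^[2d+3]≡8*[2^d*2^d] d = begin
  2 ^ (2 * d + 3)          ≡⟨ ^-distribˡ-+-* 2 (2 * d) 3 ⟩
  2 ^ (2 * d) * 8          ≡⟨ *-comm (2 ^ (2 * d)) 8 ⟩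
  8 * 2 ^ (d + (d + 0))    ≡⟨ cong (λ e → 8 * 2 ^ (d + e)) (+-identityʳ d) ⟩
  8 * 2 ^ (d + d)          ≡⟨ cong (8 *_) (^-distribˡ-+-* 2 d d) ⟩
  8 * (2 ^ d * 2 ^ d)      ∎
  where open ≡-Reasoning

theorem2p1 : (d : ℕ) → 1 ≤ d → (n : ℕ) → (G : Graph n) →
    DiameterAtMost G d → ConnectivityAtLeast G (2 ^ (2 * d + 3)) →
    PebblingNumberIs G n
-- Connectivity includes `k < n`, which excludes the empty graph.
theorem2p1 d 1≤d zero G diam (() , _)
theorem2p1 d 1≤d n@(suc _) G diam conn =
  solvable G d diam (subst (ConnectivityAtLeast G) (2^[2d+3]≡8*[2^d*2^d] d) conn) ,
  solvable⇒≥ G
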